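{- Let $T$ be a consistent, recursively enumerable theory extending Robinson's arithmetic $\mathsf{Q}$, and suppose that the Weak Diagonal Lemma holds for $T$, i.e. for every formula $\Psi(x)$ with exactly one free variable $x$ there exists a sentence $\theta$ such that $T+(\Psi(\ulcorner\theta\urcorner)\leftrightarrow\theta)$ is consistent. Then there exists a sentence $\rho$ that is independent from $T$, i.e. $T\nvdash\rho$ and $T\nvdash\neg\rho$.
   Context: $\ulcorner\theta\urcorner$ denotes the numeral of the Gödel code of $\theta$ under a fixed suitable Gödel coding. -}

module Defs where

open import Data.Nat using (ℕ; zero; suc; _+_; _*_; _∸_; _<_; _<ᵇ_; _≡ᵇ_; ⌊_/2⌋)
open import Data.Bool using (if_then_else_)
open import Data.Fin using (Fin)
open import Data.Vec using (Vec; []; _∷_; lookup)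
open import Data.Product using (Σ; ∃; _×_; _,_)
open import Data.Sum using (_⊎_)
open import Data.Empty using (⊥)
open import Relation.Nullary using (¬_)
open import Relation.Binary.PropositionalEquality using (_≡_)

infixr 5 _⇒_
infix 7 _≐_
infixl 8 _⊕_
infixl 9 _⊗_

data Term : Set where
  var  : ℕ → Term
  𝟎    : Term
  S    : Term → Term
  _⊕_  : Term → Term → Term
  _⊗_  : Term → Term → Term

data Formula : Set where
  ⊥'   : Formula
  _≐_  : Term → Term → Formula
  _⇒_  : Formula → Formula → Formula
  ∀'   : Formula → Formula      -- binds de Bruijn index 0

¬' : Formula → Formula
¬' φ = φ ⇒ ⊥'

_∧'_ : Formula → Formula → Formula
φ ∧' ψ = ¬' (φ ⇒ ¬' ψ)

_⇔_ : Formula → Formula → Formula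
φ ⇔ ψ = (φ ⇒ ψ) ∧' (ψ ⇒ φ)

∃' : Formula → Formula
∃' φ = ¬' (∀' (¬' φ))

num : ℕ → Term
num zero    = 𝟎
num (suc n) = S (num n)

data FreeT (k : ℕ) : Term → Set where
  here : FreeT k (var k)
  S-   : ∀ {t} → FreeT k t → FreeT k (S t)
  ⊕ˡ   : ∀ {t u} → FreeT k t → FreeT k (t ⊕ u)
  ⊕ʳ   : ∀ {t u} → FreeT k u → FreeT k (t ⊕ u)
  ⊗ˡ   : ∀ {t u} → FreeT k t → FreeT k (t ⊗ u)
  ⊗ʳ   : ∀ {t u} → FreeT k u → FreeT k (t ⊗ u)

data Free : ℕ → Formula → Set where
  ≐ˡ  : ∀ {k t u} → FreeT k t → Free k (t ≐ u)
  ≐ʳ  : ∀ {k t u} → FreeT k u → Free k (t ≐ u)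
  ⇒ˡ  : ∀ {k φ ψ} → Free k φ → Free k (φ ⇒ ψ)
  ⇒ʳ  : ∀ {k φ ψ} → Free k ψ → Free k (φ ⇒ ψ)
  ∀-  : ∀ {k φ} → Free (suc k) φ → Free k (∀' φ)

Sentence : Formula → Set
Sentence φ = ∀ k → ¬ Free k φ

OneFreeVar : Formula → Set
OneFreeVar Ψ = Free 0 Ψ × (∀ k → Free k Ψ → k ≡ 0)

shiftT : ℕ → Term → Term
shiftT c (var n)  = if n <ᵇ c then var n else var (suc n)
shiftT c 𝟎        = 𝟎
shiftT c (S t)    = S (shiftT c t)
shiftT c (t ⊕ u)  = shiftT c t ⊕ shiftT c u
shiftT c (t ⊗ u)  = shiftT c t ⊗ shiftT c u

shift : ℕ → Formula → Formula
shift c ⊥'       = ⊥'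
shift c (t ≐ u)  = shiftT c t ≐ shiftT c u
shift c (φ ⇒ ψ)  = shift c φ ⇒ shift c ψ
shift c (∀' φ)   = ∀' (shift (suc c) φ)

substT : ℕ → Term → Term → Term
substT c s (var n) = if n <ᵇ c then var n else (if n ≡ᵇ c then s else var (n ∸ 1))
substT c s 𝟎       = 𝟎
substT c s (S t)   = S (substT c s t)
substT c s (t ⊕ u) = substT c s t ⊕ substT c s u
substT c s (t ⊗ u) = substT c s t ⊗ substT c s u

subst : ℕ → Term → Formula → Formula
subst c s ⊥'      = ⊥'
subst c s (t ≐ u) = substT c s t ≐ substT c s u
subst c s (φ ⇒ ψ) = subst c s φ ⇒ subst c s ψ
subst c s (∀' φ)  = ∀' (subst (suc c) (shiftT 0 s) φ)

_[_] : Formula → Term → Formula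
φ [ t ] = subst 0 t φ

Theory : Set₁
Theory = Formula → Set

_+ax_ : Theory → Formula → Theory
(T +ax φ) ψ = T ψ ⊎ ψ ≡ φ

infix 3 _⊢_
data _⊢_ (T : Theory) : Formula → Set where
  ax     : ∀ {φ} → T φ → T ⊢ φ
  ax-K   : ∀ {φ ψ} → T ⊢ φ ⇒ ψ ⇒ φ
  ax-S   : ∀ {φ ψ χ} → T ⊢ (φ ⇒ ψ ⇒ χ) ⇒ (φ ⇒ ψ) ⇒ φ ⇒ χ
  ax-DN  : ∀ {φ} → T ⊢ ¬' (¬' φ) ⇒ φ
  ax-∀E  : ∀ {φ} (t : Term) → T ⊢ ∀' φ ⇒ φ [ t ]
  ax-∀⇒  : ∀ {φ ψ} → T ⊢ ∀' (φ ⇒ ψ) ⇒ ∀' φ ⇒ ∀' ψ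
  ax-∀V  : ∀ {φ} → T ⊢ φ ⇒ ∀' (shift 0 φ)
  ax-refl : ∀ (t : Term) → T ⊢ t ≐ t
  ax-leib : ∀ {φ} (t u : Term) → T ⊢ t ≐ u ⇒ φ [ t ] ⇒ φ [ u ]
  mp     : ∀ {φ ψ} → T ⊢ φ ⇒ ψ → T ⊢ φ → T ⊢ ψ
  gen    : ∀ {φ} → T ⊢ φ → T ⊢ ∀' φ

Consistent : Theory → Set
Consistent T = ¬ (T ⊢ ⊥')

SentenceTheory : Theory → Set
SentenceTheory T = ∀ φ → T φ → Sentence φ

private
  x y : Term
  x = var 1
  y = var 0

Q1 Q2 Q3 Q4 Q5 Q6 Q7 : Formula
Q1 = ∀' (¬' (S (var 0) ≐ 𝟎))
Q2 = ∀' (∀' (S x ≐ S y ⇒ x ≐ y))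
Q3 = ∀' (¬' (var 0 ≐ 𝟎) ⇒ ∃' (var 1 ≐ S (var 0)))
Q4 = ∀' (var 0 ⊕ 𝟎 ≐ var 0)
Q5 = ∀' (∀' (x ⊕ S y ≐ S (x ⊕ y)))
Q6 = ∀' (var 0 ⊗ 𝟎 ≐ 𝟎)
Q7 = ∀' (∀' (x ⊗ S y ≐ x ⊗ y ⊕ x))

ExtendsQ : Theory → Set
ExtendsQ T = (T ⊢ Q1) × (T ⊢ Q2) × (T ⊢ Q3) × (T ⊢ Q4) × (T ⊢ Q5) × (T ⊢ Q6) × (T ⊢ Q7)

-- Gödel coding (Cantor pairing)

pair : ℕ → ℕ → ℕ
pair a b = ⌊ (a + b) * suc (a + b) /2⌋ + b

⌜_⌝T : Term → ℕ
⌜ var n ⌝T = pair 0 n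
⌜ 𝟎 ⌝T     = pair 1 0
⌜ S t ⌝T   = pair 2 ⌜ t ⌝T
⌜ t ⊕ u ⌝T = pair 3 (pair ⌜ t ⌝T ⌜ u ⌝T)
⌜ t ⊗ u ⌝T = pair 4 (pair ⌜ t ⌝T ⌜ u ⌝T)

⌜_⌝ : Formula → ℕ
⌜ ⊥' ⌝    = pair 0 0
⌜ t ≐ u ⌝ = pair 1 (pair ⌜ t ⌝T ⌜ u ⌝T)
⌜ φ ⇒ ψ ⌝ = pair 2 (pair ⌜ φ ⌝ ⌜ ψ ⌝)
⌜ ∀' φ ⌝  = pair 3 ⌜ φ ⌝

⌜_⌝̇ : Formula → Term
⌜ φ ⌝̇ = num ⌜ φ ⌝

data PR : ℕ → Set where
  Z    : ∀ {n} → PR n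
  σ    : PR 1
  π    : ∀ {n} → Fin n → PR n
  comp : ∀ {m n} → PR m → Vec (PR n) m → PR n
  prec : ∀ {n} → PR n → PR (suc (suc n)) → PR (suc n)
  μ    : ∀ {n} → PR (suc n) → PR n

data Eval : ∀ {n} → PR n → Vec ℕ n → ℕ → Set
data EvalV : ∀ {n m} → Vec (PR n) m → Vec ℕ n → Vec ℕ m → Set

data Eval where
  ev-Z    : ∀ {n} {xs : Vec ℕ n} → Eval Z xs 0
  ev-σ    : ∀ {k} → Eval σ (k ∷ []) (suc k)
  ev-π    : ∀ {n} {i : Fin n} {xs} → Eval (π i) xs (lookup xs i)
  ev-comp : ∀ {m n} {f : PR m} {gs : Vec (PR n) m} {xs ys z}
            → EvalV gs xs ys → Eval f ys z → Eval (comp f gs) xs z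
  ev-rec0 : ∀ {n} {g : PR n} {h xs z} → Eval g xs z → Eval (prec g h) (0 ∷ xs) z
  ev-recS : ∀ {n} {g : PR n} {h xs k r z}
            → Eval (prec g h) (k ∷ xs) r → Eval h (k ∷ r ∷ xs) z
            → Eval (prec g h) (suc k ∷ xs) z
  ev-μ    : ∀ {n} {f : PR (suc n)} {xs y}
            → Eval f (y ∷ xs) 0
            → (∀ z → z < y → Σ ℕ λ v → Eval f (z ∷ xs) (suc v))
            → Eval (μ f) xs y

data EvalV where
  []  : ∀ {n} {xs : Vec ℕ n} → EvalV [] xs []
  _∷_ : ∀ {n m} {g : PR n} {gs : Vec (PR n) m} {xs y ys}
        → Eval g xs y → EvalV gs xs ys → EvalV (g ∷ gs) xs (y ∷ ys)

RE : (ℕ → Set) → Set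
RE A = Σ (PR 1) λ f → ∀ n → (A n → ∃ λ v → Eval f (n ∷ []) v) × ((∃ λ v → Eval f (n ∷ []) v) → A n)

RETheory : Theory → Set
RETheory T = RE (λ n → Σ Formula λ φ → T φ × ⌜ φ ⌝ ≡ n)

WeakDiagonal : Theory → Set
WeakDiagonal T = ∀ Ψ → OneFreeVar Ψ →
  Σ Formula λ θ → Sentence θ × Consistent (T +ax ((Ψ [ ⌜ θ ⌝̇ ]) ⇔ θ))

{-# OPTIONS --safe #-}
-- Provability and refutability in T are generated by finitely many Horn rules on codes of trees (for coding,
-- substitution, evaluation of the program enumerating the axioms, and deduction). A finite derivation is a finite
-- set of numbers, coded by divisibility, so "x has a proof at stage p" and "x has a refutation at stage p" are
-- bounded formulas, which Q decides at numerals. Rosser's formula "x has a refutation at a stage by which it has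
-- no proof" is then provable at ⌜θ⌝ if T refutes θ and refutable at ⌜θ⌝ if T proves θ. In either case T refutes
-- the equivalence of this formula at ⌜θ⌝ with θ, so the θ given by the Weak Diagonal Lemma is independent.
module Submission where

open import Defs
open import Data.Bool using (true; false)
open import Data.Empty using (⊥; ⊥-elim)
open import Data.Fin using (Fin; zero; suc; _↑ˡ_; _↑ʳ_; #_)
open import Data.List as List using (List; []; _∷_)
open import Data.List.Membership.Propositional using (_∈_)
open import Data.List.Membership.Propositional.Properties using (∈-map⁺; ∈-map⁻; ∈-++⁺ˡ; ∈-++⁺ʳ; ∈-++⁻; ∈-lookup)
open import Data.List.Relation.Unary.All as All using (All; []; _∷_)
open import Data.List.Relation.Unary.Any using (here; there)
open import Data.Nat using (ℕ; zero; suc; _+_; _*_; _∸_; _≤_; _<_; z≤n; s≤s; _<ᵇ_; _≡ᵇ_; ⌊_/2⌋; _≟_; _!; _⊔_; compare; less; equal; greater)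
open import Data.Nat.Coprimality using (Coprime; coprime-divisor)
open import Data.Nat.Divisibility
open import Data.Nat.ListAction using (product)
open import Data.Nat.ListAction.Properties using (∈⇒∣product)
open import Data.Nat.Properties
open import Data.Product using (Σ; ∃; _×_; _,_; proj₁; proj₂; uncurry)
open import Data.Sum using (_⊎_; inj₁; inj₂)
open import Data.Unit using (⊤)
open import Data.Vec as Vec using (Vec; []; _∷_; lookup)
open import Data.Vec.Properties using (lookup-map; lookup-++ˡ; lookup-++ʳ)
open import Relation.Binary.Definitions using (tri<; tri≈; tri>)
open import Relation.Binary.PropositionalEquality as ≡ using (_≡_; _≢_; refl; sym; trans; cong; cong₂)
open import Relation.Nullary using (¬_; Dec; yes; no)

-- Deduction in theories extending Q

-- The equivalence is only known to be consistent with `T`, so `T` itself must decide Ψ at ⌜θ⌝,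
-- against θ, both when it proves θ and when it refutes θ. Unprovability does not achieve this: if
-- `T` refutes θ, then the unprovability of θ is true, but `T` need not prove it. Comparing stages
-- helps because the relevant unprovability then concerns only the stages below one numeral. The
-- obstacle inside `T` is that Q has no induction and does not even prove its order linear. Hence
-- every induction is carried out outside `T`, and inside `T` an arbitrary number is only ever
-- compared with a numeral. Horn rules spare the representation of recursive functions in `T`: the
-- rule system is tied to `T` by soundness and completeness, both proved outside, and `T` only has
-- to verify single bounded sentences at numerals. Divisibility takes the place of Gödel's β
-- function because membership then needs one multiplication and a quotient bounded by the code.

substT-shiftT : ∀ s t → substT 0 s (shiftT 0 t) ≡ t
substT-shiftT s (var n) = refl
substT-shiftT s 𝟎       = refl
substT-shiftT s (S t)   = cong S (substT-shiftT s t)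
substT-shiftT s (t ⊕ u) = cong₂ _⊕_ (substT-shiftT s t) (substT-shiftT s u)
substT-shiftT s (t ⊗ u) = cong₂ _⊗_ (substT-shiftT s t) (substT-shiftT s u)

shiftT-shiftT : ∀ t → shiftT 1 (shiftT 0 t) ≡ shiftT 0 (shiftT 0 t)
shiftT-shiftT (var n) = refl
shiftT-shiftT 𝟎       = refl
shiftT-shiftT (S t)   = cong S (shiftT-shiftT t)
shiftT-shiftT (t ⊕ u) = cong₂ _⊕_ (shiftT-shiftT t) (shiftT-shiftT u)
shiftT-shiftT (t ⊗ u) = cong₂ _⊗_ (shiftT-shiftT t) (shiftT-shiftT u)

substT-suc-shiftT : ∀ c s t → substT (suc c) (shiftT 0 s) (shiftT 0 t) ≡ shiftT 0 (substT c s t)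
substT-suc-shiftT zero    s (var zero)    = refl
substT-suc-shiftT (suc c) s (var zero)    = refl
substT-suc-shiftT c       s (var (suc n)) with suc n <ᵇ c
... | true  = refl
... | false with suc n ≡ᵇ c
...   | true  = refl
...   | false = refl
substT-suc-shiftT c s 𝟎       = refl
substT-suc-shiftT c s (S t)   = cong S (substT-suc-shiftT c s t)
substT-suc-shiftT c s (t ⊕ u) = cong₂ _⊕_ (substT-suc-shiftT c s t) (substT-suc-shiftT c s u)
substT-suc-shiftT c s (t ⊗ u) = cong₂ _⊗_ (substT-suc-shiftT c s t) (substT-suc-shiftT c s u)

substT-num : ∀ c s n → substT c s (num n) ≡ num n
substT-num c s zero    = refl
substT-num c s (suc n) = cong S (substT-num c s n)

shiftT-num : ∀ c n → shiftT c (num n) ≡ num n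
shiftT-num c zero    = refl
shiftT-num c (suc n) = cong S (shiftT-num c n)

-- The witness stands on the left because Q5 unfolds addition along its right argument: z + S t = S
-- (z + t) is available in Q, while S t + z = S (t + z) is not.
leq : Term → Term → Formula
leq t u = ∃' (var 0 ⊕ shiftT 0 t ≐ shiftT 0 u)

subst-leq : ∀ c s t u → subst c s (leq t u) ≡ leq (substT c s t) (substT c s u)
subst-leq c s t u = cong₂ (λ a b → ∃' (var 0 ⊕ a ≐ b)) (substT-suc-shiftT c s t) (substT-suc-shiftT c s u)

shift-leq : ∀ t u → shift 0 (leq t u) ≡ leq (shiftT 0 t) (shiftT 0 u)
shift-leq t u = cong₂ (λ a b → ∃' (var 0 ⊕ a ≐ b)) (shiftT-shiftT t) (shiftT-shiftT u)

-- The disjunction t = 0 ∨ ... ∨ t = n, with α ∨ β written as ¬α ⇒ β.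
oneOf : ℕ → Term → Formula
oneOf zero    t = t ≐ 𝟎
oneOf (suc n) t = ¬' (oneOf n t) ⇒ t ≐ num (suc n)

subst-oneOf : ∀ n c s t → subst c s (oneOf n t) ≡ oneOf n (substT c s t)
subst-oneOf zero    c s t = refl
subst-oneOf (suc n) c s t = cong₂ (λ a b → ¬' a ⇒ substT c s t ≐ b) (subst-oneOf n c s t) (substT-num c s (suc n))

shift-oneOf : ∀ n c t → shift c (oneOf n t) ≡ oneOf n (shiftT c t)
shift-oneOf zero    c t = refl
shift-oneOf (suc n) c t = cong₂ (λ a b → ¬' a ⇒ shiftT c t ≐ b) (shift-oneOf n c t) (shiftT-num c (suc n))

-- Derivations under hypotheses, and equality

module Entailment (T : Theory) where

  infix 3 _⊩_
  -- Hypotheses are iterated implications, so the deduction theorem holds by definition. The head of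
  -- the list is the innermost antecedent.
  _⊩_ : List Formula → Formula → Set
  []      ⊩ φ = T ⊢ φ
  (γ ∷ Γ) ⊩ φ = Γ ⊩ γ ⇒ φ

  lift : ∀ Γ {φ} → T ⊢ φ → Γ ⊩ φ
  lift []      p = p
  lift (γ ∷ Γ) p = lift Γ (mp ax-K p)

  app : ∀ Γ {φ ψ} → Γ ⊩ φ ⇒ ψ → Γ ⊩ φ → Γ ⊩ ψ
  app []      p q = mp p q
  app (γ ∷ Γ) p q = app Γ (app Γ (lift Γ ax-S) p) q

  wk : ∀ Γ {γ φ} → Γ ⊩ φ → γ ∷ Γ ⊩ φ
  wk Γ p = app Γ (lift Γ ax-K) p

  hyp₀ : ∀ Γ {γ} → γ ∷ Γ ⊩ γ
  hyp₀ Γ {γ} = app Γ (app Γ (lift Γ (ax-S {ψ = γ ⇒ γ})) (lift Γ ax-K)) (lift Γ ax-K)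

  hyp₁ : ∀ Γ {γ δ} → δ ∷ γ ∷ Γ ⊩ γ
  hyp₁ Γ {γ} = wk (γ ∷ Γ) (hyp₀ Γ)

  hyp₂ : ∀ Γ {γ δ ε} → ε ∷ δ ∷ γ ∷ Γ ⊩ γ
  hyp₂ Γ {γ} {δ} = wk (δ ∷ γ ∷ Γ) (hyp₁ Γ)

  exfalso : ∀ Γ {φ} → Γ ⊩ ⊥' → Γ ⊩ φ
  exfalso Γ p = app Γ (lift Γ ax-DN) (wk Γ p)

  by-contradiction : ∀ Γ {φ} → ¬' φ ∷ Γ ⊩ ⊥' → Γ ⊩ φ
  by-contradiction Γ p = app Γ (lift Γ ax-DN) p

  by-cases : ∀ Γ φ {ψ} → φ ∷ Γ ⊩ ψ → ¬' φ ∷ Γ ⊩ ψ → Γ ⊩ ψ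
  by-cases Γ φ {ψ} p q = by-contradiction Γ
    (app Δ (hyp₀ Γ) (app Δ (wk Γ q) (app Δ (app Δ (lift Δ contra) (hyp₀ Γ)) (wk Γ p))))
    where
    Δ = ¬' ψ ∷ Γ
    contra : T ⊢ ¬' ψ ⇒ (φ ⇒ ψ) ⇒ ¬' φ
    contra = app Θ (hyp₂ []) (app Θ (hyp₁ (¬' ψ ∷ [])) (hyp₀ ((φ ⇒ ψ) ∷ ¬' ψ ∷ [])))
      where Θ = φ ∷ (φ ⇒ ψ) ∷ ¬' ψ ∷ []

  _⨾_ : ∀ {φ ψ χ} → T ⊢ φ ⇒ ψ → T ⊢ ψ ⇒ χ → T ⊢ φ ⇒ χ
  _⨾_ {φ} p q = app (φ ∷ []) (lift (φ ∷ []) q) p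

  contrapose : ∀ {φ ψ} → T ⊢ φ ⇒ ψ → T ⊢ ¬' ψ ⇒ ¬' φ
  contrapose {φ} {ψ} p = app Θ (hyp₁ []) (app Θ (lift Θ p) (hyp₀ (¬' ψ ∷ [])))
    where Θ = φ ∷ ¬' ψ ∷ []

  ∧-intro : ∀ Γ {φ ψ} → Γ ⊩ φ → Γ ⊩ ψ → Γ ⊩ φ ∧' ψ
  ∧-intro Γ {φ} {ψ} p q = app Δ (app Δ (hyp₀ Γ) (wk Γ p)) (wk Γ q)
    where Δ = (φ ⇒ ¬' ψ) ∷ Γ

  ∧-elim₁ : ∀ Γ {φ ψ} → Γ ⊩ φ ∧' ψ → Γ ⊩ φ
  ∧-elim₁ Γ {φ} {ψ} p = by-contradiction Γ (app Δ (wk Γ p) (exfalso (φ ∷ Δ) (app (φ ∷ Δ) (hyp₁ Γ) (hyp₀ Δ))))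
    where Δ = ¬' φ ∷ Γ

  ∧-elim₂ : ∀ Γ {φ ψ} → Γ ⊩ φ ∧' ψ → Γ ⊩ ψ
  ∧-elim₂ Γ {φ} {ψ} p = by-contradiction Γ (app Δ (wk Γ p) (wk Δ (hyp₀ Γ)))
    where Δ = ¬' ψ ∷ Γ

  ∃-intro : ∀ {φ} t → T ⊢ φ [ t ] ⇒ ∃' φ
  ∃-intro {φ} t = app Θ (app Θ (lift Θ (ax-∀E {φ = ¬' φ} t)) (hyp₀ (φ [ t ] ∷ []))) (hyp₁ [])
    where Θ = ∀' (¬' φ) ∷ φ [ t ] ∷ []

  -- By contraposition: since χ is shifted, `ax-∀V` may generalise ¬χ vacuously, which yields ∀¬φ
  -- from ¬χ.
  ∃-elim : ∀ {φ χ} → T ⊢ φ ⇒ shift 0 χ → T ⊢ ∃' φ ⇒ χ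
  ∃-elim {φ} {χ} p = by-contradiction (∃' φ ∷ []) (app Θ (hyp₁ []) (app Θ (lift Θ none) (hyp₀ (∃' φ ∷ []))))
    where
    Θ = ¬' χ ∷ ∃' φ ∷ []
    none : T ⊢ ¬' χ ⇒ ∀' (¬' φ)
    none = ax-∀V ⨾ mp ax-∀⇒ (gen (contrapose p))

  ∀-elim : ∀ {φ} t → T ⊢ ∀' φ → T ⊢ φ [ t ]
  ∀-elim t p = mp (ax-∀E t) p

  ≐-sym : ∀ {t u} → T ⊢ t ≐ u ⇒ u ≐ t
  ≐-sym {t} {u} = app Γ (≡.subst (λ a → T ⊢ t ≐ u ⇒ t ≐ a ⇒ u ≐ t) (substT-shiftT t t)
      (≡.subst (λ a → T ⊢ t ≐ u ⇒ t ≐ substT 0 t (shiftT 0 t) ⇒ u ≐ a) (substT-shiftT u t)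
        (ax-leib {φ = var 0 ≐ shiftT 0 t} t u)))
      (lift Γ (ax-refl t))
    where Γ = t ≐ u ∷ []

  ≐-trans : ∀ {t u v} → T ⊢ t ≐ u ⇒ u ≐ v ⇒ t ≐ v
  ≐-trans {t} {u} {v} = app Θ (app Θ (lift Θ leib) (hyp₀ (t ≐ u ∷ []))) (hyp₁ [])
    where
    Θ = u ≐ v ∷ t ≐ u ∷ []
    leib : T ⊢ u ≐ v ⇒ t ≐ u ⇒ t ≐ v
    leib = ≡.subst₂ (λ a b → T ⊢ u ≐ v ⇒ a ≐ u ⇒ b ≐ v) (substT-shiftT u t) (substT-shiftT v t)
             (ax-leib {φ = shiftT 0 t ≐ var 0} u v)

  -- `F` is `f` with variable 0 in its argument place: Leibniz's axiom substitutes into formulas, so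
  -- the context has to be a term with a hole.
  ≐-cong : ∀ (f : Term → Term) (F : Term) → (∀ t → substT 0 t F ≡ f t) → ∀ {t u} → T ⊢ t ≐ u ⇒ f t ≐ f u
  ≐-cong f F F-spec {t} {u} = app Γ (≡.subst₂ (λ a b → T ⊢ t ≐ u ⇒ f t ≐ a ⇒ f t ≐ b) (F-spec t) (F-spec u)
      (≡.subst₂ (λ a b → T ⊢ t ≐ u ⇒ a ≐ substT 0 t F ⇒ b ≐ substT 0 u F) (substT-shiftT t (f t)) (substT-shiftT u (f t))
        (ax-leib {φ = shiftT 0 (f t) ≐ F} t u)))
      (lift Γ (ax-refl (f t)))
    where Γ = t ≐ u ∷ []

  S-cong : ∀ {t u} → T ⊢ t ≐ u ⇒ S t ≐ S u
  S-cong = ≐-cong S (S (var 0)) (λ _ → refl)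

  ⊕-congˡ : ∀ {t u v} → T ⊢ t ≐ u ⇒ t ⊕ v ≐ u ⊕ v
  ⊕-congˡ {v = v} = ≐-cong (_⊕ v) (var 0 ⊕ shiftT 0 v) (λ t → cong (t ⊕_) (substT-shiftT t v))

  ⊕-congʳ : ∀ {t u v} → T ⊢ t ≐ u ⇒ v ⊕ t ≐ v ⊕ u
  ⊕-congʳ {v = v} = ≐-cong (v ⊕_) (shiftT 0 v ⊕ var 0) (λ t → cong (_⊕ t) (substT-shiftT t v))

  ⊗-congˡ : ∀ {t u v} → T ⊢ t ≐ u ⇒ t ⊗ v ≐ u ⊗ v
  ⊗-congˡ {v = v} = ≐-cong (_⊗ v) (var 0 ⊗ shiftT 0 v) (λ t → cong (t ⊗_) (substT-shiftT t v))

  ⊗-congʳ : ∀ {t u v} → T ⊢ t ≐ u ⇒ v ⊗ t ≐ v ⊗ u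
  ⊗-congʳ {v = v} = ≐-cong (v ⊗_) (shiftT 0 v ⊗ var 0) (λ t → cong (_⊗ t) (substT-shiftT t v))

  ⊩-trans : ∀ Γ {t u v} → Γ ⊩ t ≐ u → Γ ⊩ u ≐ v → Γ ⊩ t ≐ v
  ⊩-trans Γ p q = app Γ (app Γ (lift Γ ≐-trans) p) q

  ⊩-sym : ∀ Γ {t u} → Γ ⊩ t ≐ u → Γ ⊩ u ≐ t
  ⊩-sym Γ p = app Γ (lift Γ ≐-sym) p

  oneOf-elim : ∀ n {t χ} → (∀ i → i ≤ n → T ⊢ t ≐ num i ⇒ χ) → T ⊢ oneOf n t ⇒ χ
  oneOf-elim zero    p = p 0 z≤n
  oneOf-elim (suc n) {t} {χ} p = by-cases Γ (oneOf n t) (lift Γ (oneOf-elim n λ i i≤n → p i (m≤n⇒m≤1+n i≤n)))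
      (app (¬' (oneOf n t) ∷ Γ) (lift (¬' (oneOf n t) ∷ Γ) (p (suc n) ≤-refl))
        (app (¬' (oneOf n t) ∷ Γ) (hyp₁ []) (hyp₀ Γ)))
    where Γ = oneOf (suc n) t ∷ []

  zero-oneOf : ∀ n {t} → T ⊢ t ≐ 𝟎 ⇒ oneOf n t
  zero-oneOf zero        = hyp₀ []
  zero-oneOf (suc n) {t} = exfalso Θ (app Θ (hyp₀ (t ≐ 𝟎 ∷ [])) (app Θ (lift Θ (zero-oneOf n)) (hyp₁ [])))
    where Θ = ¬' (oneOf n t) ∷ t ≐ 𝟎 ∷ []

  oneOf-S : ∀ n {t} → T ⊢ oneOf n t ⇒ oneOf (suc n) (S t)
  oneOf-S zero {t} = wk (t ≐ 𝟎 ∷ []) S-cong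
  oneOf-S (suc n) {t} = app Θ (lift Θ S-cong) (app Θ (hyp₁ [])
      (app Θ (lift Θ (contrapose (oneOf-S n))) (hyp₀ (oneOf (suc n) t ∷ []))))
    where Θ = ¬' (oneOf (suc n) (S t)) ∷ oneOf (suc n) t ∷ []

  oneOf-≐ : ∀ n {t u} → T ⊢ t ≐ u ⇒ oneOf n t ⇒ oneOf n u
  oneOf-≐ n {t} {u} = ≡.subst₂ (λ a b → T ⊢ t ≐ u ⇒ a ⇒ b) (subst-oneOf n 0 t (var 0)) (subst-oneOf n 0 u (var 0))
      (ax-leib {φ = oneOf n (var 0)} t u)

  leq-≐ˡ : ∀ {t u v} → T ⊢ t ≐ u ⇒ leq t v ⇒ leq u v
  leq-≐ˡ {t} {u} {v} = ≡.subst₂ (λ a b → T ⊢ t ≐ u ⇒ a ⇒ b) (lemma t) (lemma u)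
      (ax-leib {φ = leq (var 0) (shiftT 0 v)} t u)
    where
    lemma : ∀ s → leq (var 0) (shiftT 0 v) [ s ] ≡ leq s v
    lemma s = trans (subst-leq 0 s (var 0) (shiftT 0 v)) (cong (leq s) (substT-shiftT s v))

  leq-≐ʳ : ∀ {t u v} → T ⊢ t ≐ u ⇒ leq v t ⇒ leq v u
  leq-≐ʳ {t} {u} {v} = ≡.subst₂ (λ a b → T ⊢ t ≐ u ⇒ a ⇒ b) (lemma t) (lemma u)
      (ax-leib {φ = leq (shiftT 0 v) (var 0)} t u)
    where
    lemma : ∀ s → leq (shiftT 0 v) (var 0) [ s ] ≡ leq v s
    lemma s = trans (subst-leq 0 s (shiftT 0 v) (var 0)) (cong (λ a → leq a s) (substT-shiftT s v))

  leq-intro : ∀ s {t u} → T ⊢ s ⊕ t ≐ u ⇒ leq t u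
  leq-intro s {t} {u} = ≡.subst₂ (λ a b → T ⊢ s ⊕ a ≐ b ⇒ leq t u) (substT-shiftT s t) (substT-shiftT s u)
      (∃-intro {φ = var 0 ⊕ shiftT 0 t ≐ shiftT 0 u} s)

-- Numerals and order in Q

module Arithmetic (T : Theory) (Q : ExtendsQ T) where

  open Entailment T

  q1 = proj₁ Q
  q2 = proj₁ (proj₂ Q)
  q3 = proj₁ (proj₂ (proj₂ Q))
  q4 = proj₁ (proj₂ (proj₂ (proj₂ Q)))
  q5 = proj₁ (proj₂ (proj₂ (proj₂ (proj₂ Q))))
  q6 = proj₁ (proj₂ (proj₂ (proj₂ (proj₂ (proj₂ Q)))))
  q7 = proj₂ (proj₂ (proj₂ (proj₂ (proj₂ (proj₂ Q)))))

  S≢𝟎 : ∀ t → T ⊢ ¬' (S t ≐ 𝟎)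
  S≢𝟎 t = ∀-elim t q1

  S-injective : ∀ t u → T ⊢ S t ≐ S u ⇒ t ≐ u
  S-injective t u = ≡.subst (λ a → T ⊢ S a ≐ S u ⇒ a ≐ u) (substT-shiftT u t) (∀-elim u (∀-elim t q2))

  𝟎-or-S : ∀ t → T ⊢ ¬' (t ≐ 𝟎) ⇒ ∃' (shiftT 0 t ≐ S (var 0))
  𝟎-or-S t = ∀-elim t q3

  ⊕-𝟎 : ∀ t → T ⊢ t ⊕ 𝟎 ≐ t
  ⊕-𝟎 t = ∀-elim t q4

  ⊕-S : ∀ t u → T ⊢ t ⊕ S u ≐ S (t ⊕ u)
  ⊕-S t u = ≡.subst (λ a → T ⊢ a ⊕ S u ≐ S (a ⊕ u)) (substT-shiftT u t) (∀-elim u (∀-elim t q5))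

  ⊗-𝟎 : ∀ t → T ⊢ t ⊗ 𝟎 ≐ 𝟎
  ⊗-𝟎 t = ∀-elim t q6

  ⊗-S : ∀ t u → T ⊢ t ⊗ S u ≐ t ⊗ u ⊕ t
  ⊗-S t u = ≡.subst (λ a → T ⊢ a ⊗ S u ≐ a ⊗ u ⊕ a) (substT-shiftT u t) (∀-elim u (∀-elim t q7))

  num-⊕ : ∀ m n → T ⊢ num m ⊕ num n ≐ num (m + n)
  num-⊕ m zero    rewrite +-identityʳ m = ⊕-𝟎 (num m)
  num-⊕ m (suc n) rewrite +-suc m n = ⊩-trans [] (⊕-S _ _) (mp S-cong (num-⊕ m n))

  num-⊗ : ∀ m n → T ⊢ num m ⊗ num n ≐ num (m * n)
  num-⊗ m zero    rewrite *-zeroʳ m = ⊗-𝟎 (num m)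
  num-⊗ m (suc n) rewrite *-suc m n | +-comm m (m * n) =
    ⊩-trans [] (⊗-S _ _) (⊩-trans [] (mp ⊕-congˡ (num-⊗ m n)) (num-⊕ (m * n) m))

  num-≢ : ∀ m n → m ≢ n → T ⊢ ¬' (num m ≐ num n)
  num-≢ zero    zero    m≢n = ⊥-elim (m≢n refl)
  num-≢ zero    (suc n) m≢n = ≐-sym ⨾ S≢𝟎 (num n)
  num-≢ (suc m) zero    m≢n = S≢𝟎 (num m)
  num-≢ (suc m) (suc n) m≢n = S-injective (num m) (num n) ⨾ num-≢ m n (λ m≡n → m≢n (cong suc m≡n))

  num-≤ : ∀ {m n} → m ≤ n → T ⊢ leq (num m) (num n)
  num-≤ {m} {n} m≤n = mp (leq-intro (num (n ∸ m)))
    (≡.subst (λ k → T ⊢ num (n ∸ m) ⊕ num m ≐ num k) (m∸n+n≡m m≤n) (num-⊕ (n ∸ m) m))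

  -- Q3, the only case distinction on an arbitrary number that Q offers; variable 0 is the
  -- predecessor.
  𝟎-S-cases : ∀ {χ} t → T ⊢ t ≐ 𝟎 ⇒ χ → T ⊢ shiftT 0 t ≐ S (var 0) ⇒ shift 0 χ → T ⊢ χ
  𝟎-S-cases {χ} t p q = by-cases [] (t ≐ 𝟎) p (𝟎-or-S t ⨾ ∃-elim {χ = χ} q)

  -- Induction on `n` outside `T`. If t = S w, then S (s + w) = n by Q5; this contradicts Q1 for n =
  -- 0, and otherwise Q2 cancels one successor and the induction hypothesis applies to `w`.
  summand-oneOf : ∀ n s t → T ⊢ s ⊕ t ≐ num n ⇒ oneOf n t
  summand-oneOf n s t = 𝟎-S-cases {s ⊕ t ≐ num n ⇒ oneOf n t} t
      (app Γ₀ (lift Γ₀ ax-K) (zero-oneOf n))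
      (≡.subst₂ (λ a b → T ⊢ shiftT 0 t ≐ S (var 0) ⇒ shiftT 0 s ⊕ shiftT 0 t ≐ a ⇒ b)
        (sym (shiftT-num 0 n)) (sym (shift-oneOf n 0 t)) (successor n (shiftT 0 s) (shiftT 0 t) (var 0)))
    where
    Γ₀ = t ≐ 𝟎 ∷ []
    successor : ∀ n s t w → T ⊢ t ≐ S w ⇒ s ⊕ t ≐ num n ⇒ oneOf n t
    successor n s t w = by n
      where
      Θ : ℕ → List Formula
      Θ n = s ⊕ t ≐ num n ∷ t ≐ S w ∷ []
      S-sum : ∀ n → Θ n ⊩ S (s ⊕ w) ≐ num n
      S-sum n = ⊩-trans (Θ n) (⊩-sym (Θ n) (⊩-trans (Θ n) (app (Θ n) (lift (Θ n) ⊕-congʳ) (hyp₁ [])) (lift (Θ n) (⊕-S s w))))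
                  (hyp₀ (t ≐ S w ∷ []))
      by : ∀ n → Θ n ⊩ oneOf n t
      by zero    = exfalso (Θ 0) (app (Θ 0) (lift (Θ 0) (S≢𝟎 (s ⊕ w))) (S-sum 0))
      by (suc n) = app Δ (app Δ (lift Δ (oneOf-≐ (suc n))) (⊩-sym Δ (hyp₁ [])))
          (app Δ (lift Δ (oneOf-S n)) (app Δ (lift Δ (summand-oneOf n s w))
            (app Δ (lift Δ (S-injective (s ⊕ w) (num n))) (S-sum (suc n)))))
        where Δ = Θ (suc n)

  leq-oneOf : ∀ n t → T ⊢ leq t (num n) ⇒ oneOf n t
  leq-oneOf n t = ∃-elim {χ = oneOf n t} (≡.subst₂ (λ a b → T ⊢ var 0 ⊕ shiftT 0 t ≐ a ⇒ b) (sym (shiftT-num 0 n)) (sym (shift-oneOf n 0 t))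
      (summand-oneOf n (var 0) (shiftT 0 t)))

  leq-S : ∀ t u → T ⊢ leq t u ⇒ leq (S t) (S u)
  leq-S t u = ∃-elim {χ = leq (S t) (S u)} (≡.subst (λ a → T ⊢ var 0 ⊕ t' ≐ u' ⇒ a) (sym (shift-leq (S t) (S u)))
      (app Γ (lift Γ (leq-intro (var 0))) (⊩-trans Γ (lift Γ (⊕-S (var 0) t')) S-cong)))
    where
    t' = shiftT 0 t
    u' = shiftT 0 u
    Γ = var 0 ⊕ t' ≐ u' ∷ []

  -- Again an induction outside `T`: in the step, t = 0 lies below the numeral, and for t = S w the
  -- comparison of `w` with the smaller numeral is lifted by `leq-S`.
  leq-connex : ∀ n t → T ⊢ ¬' (leq t (num n)) ⇒ leq (num n) t
  leq-connex zero    t = lift (¬' (leq t 𝟎) ∷ []) (mp (leq-intro t) (⊕-𝟎 t))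
  leq-connex (suc n) t = 𝟎-S-cases {¬' (leq t (num (suc n))) ⇒ leq (num (suc n)) t} t
      (exfalso Θ (app Θ (hyp₀ (t ≐ 𝟎 ∷ []))
        (app Θ (lift Θ (leq-intro (num (suc n)))) (⊩-trans Θ (app Θ (lift Θ ⊕-congʳ) (hyp₁ [])) (lift Θ (⊕-𝟎 (num (suc n))))))))
      (≡.subst₂ (λ a b → T ⊢ t' ≐ S (var 0) ⇒ ¬' a ⇒ b)
        (sym (trans (shift-leq t (num (suc n))) (cong (leq t') (shiftT-num 0 (suc n)))))
        (sym (trans (shift-leq (num (suc n)) t) (cong (λ a → leq a t') (shiftT-num 0 (suc n)))))
        (by-cases Δ (leq (var 0) (num n))
          (exfalso Δ₁ (app Δ₁ (hyp₁ (t' ≐ S (var 0) ∷ []))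
            (app Δ₁ (app Δ₁ (lift Δ₁ (leq-≐ˡ {v = num (suc n)})) (⊩-sym Δ₁ (hyp₂ []))) (app Δ₁ (lift Δ₁ (leq-S (var 0) (num n))) (hyp₀ Δ)))))
          (app Δ₂ (app Δ₂ (lift Δ₂ (leq-≐ʳ {v = num (suc n)})) (⊩-sym Δ₂ (hyp₂ [])))
            (app Δ₂ (lift Δ₂ (leq-S (num n) (var 0))) (app Δ₂ (lift Δ₂ (leq-connex n (var 0))) (hyp₀ Δ))))))
    where
    t' = shiftT 0 t
    Θ = ¬' (leq t (num (suc n))) ∷ t ≐ 𝟎 ∷ []
    Δ = ¬' (leq t' (num (suc n))) ∷ t' ≐ S (var 0) ∷ []
    Δ₁ = leq (var 0) (num n) ∷ Δ
    Δ₂ = ¬' (leq (var 0) (num n)) ∷ Δ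

-- Bounded formulas

infix 9 `_
infixl 6 _`+_
infixl 7 _`*_
infix 4 _`≡_
infixr 3 _`∧_
infixr 2 _`∨_
infixr 1 _`⇒_

data Tm (n : ℕ) : Set where
  `_        : Fin n → Tm n
  `0        : Tm n
  `suc      : Tm n → Tm n
  _`+_ _`*_ : Tm n → Tm n → Tm n

-- Bounds are variables, not terms. This suffices because the stage bounds the numbers coding a
-- derivation and these bound everything else.
data Bounded (n : ℕ) : Set where
  `⊥             : Bounded n
  _`≡_           : Tm n → Tm n → Bounded n
  _`∧_ _`∨_ _`⇒_ : Bounded n → Bounded n → Bounded n
  `∀≤ `∃≤        : Fin n → Bounded (suc n) → Bounded n

⟦_⟧ᵗ : ∀ {n} → Tm n → Vec ℕ n → ℕ
⟦ ` i ⟧ᵗ    ρ = lookup ρ i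
⟦ `0 ⟧ᵗ     ρ = 0
⟦ `suc t ⟧ᵗ ρ = suc (⟦ t ⟧ᵗ ρ)
⟦ t `+ u ⟧ᵗ ρ = ⟦ t ⟧ᵗ ρ + ⟦ u ⟧ᵗ ρ
⟦ t `* u ⟧ᵗ ρ = ⟦ t ⟧ᵗ ρ * ⟦ u ⟧ᵗ ρ

⟦_⟧ : ∀ {n} → Bounded n → Vec ℕ n → Set
⟦ `⊥ ⟧     ρ = ⊥
⟦ t `≡ u ⟧ ρ = ⟦ t ⟧ᵗ ρ ≡ ⟦ u ⟧ᵗ ρ
⟦ φ `∧ ψ ⟧ ρ = ⟦ φ ⟧ ρ × ⟦ ψ ⟧ ρ
⟦ φ `∨ ψ ⟧ ρ = ⟦ φ ⟧ ρ ⊎ ⟦ ψ ⟧ ρ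
⟦ φ `⇒ ψ ⟧ ρ = ⟦ φ ⟧ ρ → ⟦ ψ ⟧ ρ
⟦ `∀≤ i φ ⟧ ρ = ∀ k → k ≤ lookup ρ i → ⟦ φ ⟧ (k ∷ ρ)
⟦ `∃≤ i φ ⟧ ρ = ∃ λ k → k ≤ lookup ρ i × ⟦ φ ⟧ (k ∷ ρ)

instᵗ : ∀ {n} → Tm n → Vec Term n → Term
instᵗ (` i)    ρ = lookup ρ i
instᵗ `0       ρ = 𝟎
instᵗ (`suc t) ρ = S (instᵗ t ρ)
instᵗ (t `+ u) ρ = instᵗ t ρ ⊕ instᵗ u ρ
instᵗ (t `* u) ρ = instᵗ t ρ ⊗ instᵗ u ρ

-- The environment holds arbitrary terms, so one definition gives both the instances at numerals
-- that Q decides and the open formulas inside Rosser's formula.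
inst : ∀ {n} → Bounded n → Vec Term n → Formula
inst `⊥       ρ = ⊥'
inst (t `≡ u) ρ = instᵗ t ρ ≐ instᵗ u ρ
inst (φ `∧ ψ) ρ = inst φ ρ ∧' inst ψ ρ
inst (φ `∨ ψ) ρ = ¬' (inst φ ρ) ⇒ inst ψ ρ
inst (φ `⇒ ψ) ρ = inst φ ρ ⇒ inst ψ ρ
inst (`∀≤ i φ) ρ = ∀' (leq (var 0) (shiftT 0 (lookup ρ i)) ⇒ inst φ (var 0 ∷ Vec.map (shiftT 0) ρ))
inst (`∃≤ i φ) ρ = ∃' (leq (var 0) (shiftT 0 (lookup ρ i)) ∧' inst φ (var 0 ∷ Vec.map (shiftT 0) ρ))

subst-instᵗ : ∀ {n} c s (t : Tm n) ρ → substT c s (instᵗ t ρ) ≡ instᵗ t (Vec.map (substT c s) ρ)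
subst-instᵗ c s (` i)    ρ = sym (lookup-map i (substT c s) ρ)
subst-instᵗ c s `0       ρ = refl
subst-instᵗ c s (`suc t) ρ = cong S (subst-instᵗ c s t ρ)
subst-instᵗ c s (t `+ u) ρ = cong₂ _⊕_ (subst-instᵗ c s t ρ) (subst-instᵗ c s u ρ)
subst-instᵗ c s (t `* u) ρ = cong₂ _⊗_ (subst-instᵗ c s t ρ) (subst-instᵗ c s u ρ)

map-subst-shift : ∀ {n} c s (ρ : Vec Term n) →
  Vec.map (substT (suc c) (shiftT 0 s)) (Vec.map (shiftT 0) ρ) ≡ Vec.map (shiftT 0) (Vec.map (substT c s) ρ)
map-subst-shift c s []      = refl
map-subst-shift c s (t ∷ ρ) = cong₂ _∷_ (substT-suc-shiftT c s t) (map-subst-shift c s ρ)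

subst-inst : ∀ {n} c s (φ : Bounded n) ρ → subst c s (inst φ ρ) ≡ inst φ (Vec.map (substT c s) ρ)

subst-bound : ∀ {n} c s (i : Fin n) ρ →
  subst (suc c) (shiftT 0 s) (leq (var 0) (shiftT 0 (lookup ρ i))) ≡ leq (var 0) (shiftT 0 (lookup (Vec.map (substT c s) ρ) i))
subst-bound c s i ρ = trans (subst-leq (suc c) (shiftT 0 s) (var 0) (shiftT 0 (lookup ρ i)))
  (cong (leq (var 0)) (trans (substT-suc-shiftT c s (lookup ρ i)) (cong (shiftT 0) (sym (lookup-map i (substT c s) ρ)))))

subst-body : ∀ {n} c s (φ : Bounded (suc n)) ρ →
  subst (suc c) (shiftT 0 s) (inst φ (var 0 ∷ Vec.map (shiftT 0) ρ)) ≡ inst φ (var 0 ∷ Vec.map (shiftT 0) (Vec.map (substT c s) ρ))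
subst-body c s φ ρ = trans (subst-inst (suc c) (shiftT 0 s) φ _) (cong (λ σ → inst φ (var 0 ∷ σ)) (map-subst-shift c s ρ))

subst-inst c s `⊥       ρ = refl
subst-inst c s (t `≡ u) ρ = cong₂ _≐_ (subst-instᵗ c s t ρ) (subst-instᵗ c s u ρ)
subst-inst c s (φ `∧ ψ) ρ = cong₂ _∧'_ (subst-inst c s φ ρ) (subst-inst c s ψ ρ)
subst-inst c s (φ `∨ ψ) ρ = cong₂ (λ α β → ¬' α ⇒ β) (subst-inst c s φ ρ) (subst-inst c s ψ ρ)
subst-inst c s (φ `⇒ ψ) ρ = cong₂ _⇒_ (subst-inst c s φ ρ) (subst-inst c s ψ ρ)
subst-inst c s (`∀≤ i φ) ρ = cong₂ (λ α β → ∀' (α ⇒ β)) (subst-bound c s i ρ) (subst-body c s φ ρ)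
subst-inst c s (`∃≤ i φ) ρ = cong₂ (λ α β → ∃' (α ∧' β)) (subst-bound c s i ρ) (subst-body c s φ ρ)

FreeIn : ∀ {n} → ℕ → Vec Term n → Set
FreeIn k ρ = ∃ λ i → FreeT k (lookup ρ i)

FreeT-shiftT : ∀ {k} t → FreeT (suc k) (shiftT 0 t) → FreeT k t
FreeT-shiftT (var n) here   = here
FreeT-shiftT (S t)   (S- p) = S- (FreeT-shiftT t p)
FreeT-shiftT (t ⊕ u) (⊕ˡ p) = ⊕ˡ (FreeT-shiftT t p)
FreeT-shiftT (t ⊕ u) (⊕ʳ p) = ⊕ʳ (FreeT-shiftT u p)
FreeT-shiftT (t ⊗ u) (⊗ˡ p) = ⊗ˡ (FreeT-shiftT t p)
FreeT-shiftT (t ⊗ u) (⊗ʳ p) = ⊗ʳ (FreeT-shiftT u p)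

FreeIn-shift : ∀ {n k} (ρ : Vec Term n) → FreeIn (suc k) (var 0 ∷ Vec.map (shiftT 0) ρ) → FreeIn k ρ
FreeIn-shift ρ (suc i , p) = i , FreeT-shiftT _ (≡.subst (FreeT _) (lookup-map i (shiftT 0) ρ) p)

Free-leq : ∀ {n k} i (ρ : Vec Term n) → Free (suc k) (leq (var 0) (shiftT 0 (lookup ρ i))) → FreeIn k ρ
Free-leq i ρ (⇒ˡ (∀- (⇒ˡ (≐ˡ (⊕ˡ ())))))
Free-leq i ρ (⇒ˡ (∀- (⇒ˡ (≐ˡ (⊕ʳ ())))))
Free-leq i ρ (⇒ˡ (∀- (⇒ˡ (≐ʳ p)))) = i , FreeT-shiftT _ (FreeT-shiftT _ p)

Free-instᵗ : ∀ {n k} (t : Tm n) ρ → FreeT k (instᵗ t ρ) → FreeIn k ρ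
Free-instᵗ (` i)    ρ p      = i , p
Free-instᵗ (`suc t) ρ (S- p) = Free-instᵗ t ρ p
Free-instᵗ (t `+ u) ρ (⊕ˡ p) = Free-instᵗ t ρ p
Free-instᵗ (t `+ u) ρ (⊕ʳ p) = Free-instᵗ u ρ p
Free-instᵗ (t `* u) ρ (⊗ˡ p) = Free-instᵗ t ρ p
Free-instᵗ (t `* u) ρ (⊗ʳ p) = Free-instᵗ u ρ p

Free-inst : ∀ {n k} (φ : Bounded n) ρ → Free k (inst φ ρ) → FreeIn k ρ
Free-inst (t `≡ u) ρ (≐ˡ p) = Free-instᵗ t ρ p
Free-inst (t `≡ u) ρ (≐ʳ p) = Free-instᵗ u ρ p
Free-inst (φ `∧ ψ) ρ (⇒ˡ (⇒ˡ p))      = Free-inst φ ρ p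
Free-inst (φ `∧ ψ) ρ (⇒ˡ (⇒ʳ (⇒ˡ p))) = Free-inst ψ ρ p
Free-inst (φ `∨ ψ) ρ (⇒ˡ (⇒ˡ p))      = Free-inst φ ρ p
Free-inst (φ `∨ ψ) ρ (⇒ʳ p)           = Free-inst ψ ρ p
Free-inst (φ `⇒ ψ) ρ (⇒ˡ p) = Free-inst φ ρ p
Free-inst (φ `⇒ ψ) ρ (⇒ʳ p) = Free-inst ψ ρ p
Free-inst (`∀≤ i φ) ρ (∀- (⇒ˡ p)) = Free-leq i ρ p
Free-inst (`∀≤ i φ) ρ (∀- (⇒ʳ p)) = FreeIn-shift ρ (Free-inst φ _ p)
Free-inst (`∃≤ i φ) ρ (⇒ˡ (∀- (⇒ˡ (⇒ˡ (⇒ˡ p)))))      = Free-leq i ρ p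
Free-inst (`∃≤ i φ) ρ (⇒ˡ (∀- (⇒ˡ (⇒ˡ (⇒ʳ (⇒ˡ p)))))) = FreeIn-shift ρ (Free-inst φ _ p)

nums : ∀ {n} → Vec ℕ n → Vec Term n
nums = Vec.map num

lookup-nums : ∀ {n} (ρ : Vec ℕ n) i → lookup (nums ρ) i ≡ num (lookup ρ i)
lookup-nums ρ i = lookup-map i num ρ

map-shift-nums : ∀ {n} (ρ : Vec ℕ n) → Vec.map (shiftT 0) (nums ρ) ≡ nums ρ
map-shift-nums []      = refl
map-shift-nums (k ∷ ρ) = cong₂ _∷_ (shiftT-num 0 k) (map-shift-nums ρ)

map-subst-nums : ∀ {n} c s (ρ : Vec ℕ n) → Vec.map (substT c s) (nums ρ) ≡ nums ρ
map-subst-nums c s []      = refl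
map-subst-nums c s (k ∷ ρ) = cong₂ _∷_ (substT-num c s k) (map-subst-nums c s ρ)

inst-[] : ∀ {n} (φ : Bounded (suc n)) ρ t → inst φ (var 0 ∷ nums ρ) [ t ] ≡ inst φ (t ∷ nums ρ)
inst-[] φ ρ t = trans (subst-inst 0 t φ (var 0 ∷ nums ρ)) (cong (λ σ → inst φ (t ∷ σ)) (map-subst-nums 0 t ρ))

inst-bound : ∀ {n} (i : Fin n) (ρ : Vec ℕ n) →
  leq (var 0) (shiftT 0 (lookup (nums ρ) i)) ≡ leq (var 0) (num (lookup ρ i))
inst-bound i ρ = cong (leq (var 0)) (trans (cong (shiftT 0) (lookup-nums ρ i)) (shiftT-num 0 (lookup ρ i)))

inst-∀≤ : ∀ {n} i (φ : Bounded (suc n)) (ρ : Vec ℕ n) →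
  inst (`∀≤ i φ) (nums ρ) ≡ ∀' (leq (var 0) (num (lookup ρ i)) ⇒ inst φ (var 0 ∷ nums ρ))
inst-∀≤ i φ ρ = cong₂ (λ α σ → ∀' (α ⇒ inst φ (var 0 ∷ σ))) (inst-bound i ρ) (map-shift-nums ρ)

inst-∃≤ : ∀ {n} i (φ : Bounded (suc n)) (ρ : Vec ℕ n) →
  inst (`∃≤ i φ) (nums ρ) ≡ ∃' (leq (var 0) (num (lookup ρ i)) ∧' inst φ (var 0 ∷ nums ρ))
inst-∃≤ i φ ρ = cong₂ (λ α σ → ∃' (α ∧' inst φ (var 0 ∷ σ))) (inst-bound i ρ) (map-shift-nums ρ)

-- Truth and provability of bounded formulas at numerals

module Decision (T : Theory) (Q : ExtendsQ T) where

  open Entailment T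
  open Arithmetic T Q

  -- Both outcomes carry a derivation, since the induction on formulas passes through implications
  -- and through refuted instances of quantifiers.
  data Decided (P : Set) (φ : Formula) : Set where
    holds : P → T ⊢ φ → Decided P φ
    fails : ¬ P → T ⊢ ¬' φ → Decided P φ

  eval : ∀ {n} (t : Tm n) (ρ : Vec ℕ n) → T ⊢ instᵗ t (nums ρ) ≐ num (⟦ t ⟧ᵗ ρ)
  eval (` i) ρ    = ≡.subst (λ u → T ⊢ u ≐ num (lookup ρ i)) (sym (lookup-nums ρ i)) (ax-refl _)
  eval `0 ρ       = ax-refl 𝟎
  eval (`suc t) ρ = mp S-cong (eval t ρ)
  eval (t `+ u) ρ = ⊩-trans [] (mp ⊕-congˡ (eval t ρ)) (⊩-trans [] (mp ⊕-congʳ (eval u ρ)) (num-⊕ _ _))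
  eval (t `* u) ρ = ⊩-trans [] (mp ⊗-congˡ (eval t ρ)) (⊩-trans [] (mp ⊗-congʳ (eval u ρ)) (num-⊗ _ _))

  -- A bound by a numeral is a finite disjunction by `leq-oneOf`, and in each disjunct Leibniz's
  -- axiom carries the proved instance over to `t`.
  upTo-num : ∀ {n} b (φ : Bounded (suc n)) (ρ : Vec ℕ n) → (∀ k → k ≤ b → T ⊢ inst φ (nums (k ∷ ρ))) →
    ∀ t → T ⊢ leq t (num b) ⇒ inst φ (t ∷ nums ρ)
  upTo-num b φ ρ p t = leq-oneOf b t ⨾ oneOf-elim b λ k k≤b →
    ≐-sym ⨾ app (num k ≐ t ∷ []) (≡.subst₂ (λ α β → T ⊢ num k ≐ t ⇒ α ⇒ β) (inst-[] φ ρ (num k)) (inst-[] φ ρ t)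
      (ax-leib (num k) t)) (lift (num k ≐ t ∷ []) (p k k≤b))

  instance-upTo-num : ∀ {n} b (φ : Bounded (suc n)) (ρ : Vec ℕ n) {k} → k ≤ b →
    T ⊢ ∀' (leq (var 0) (num b) ⇒ inst φ (var 0 ∷ nums ρ)) ⇒ inst φ (nums (k ∷ ρ))
  instance-upTo-num b φ ρ {k} k≤b = app (α ∷ [])
      (≡.subst₂ (λ β γ → T ⊢ α ⇒ β ⇒ γ)
        (trans (subst-leq 0 (num k) (var 0) (num b)) (cong (leq (num k)) (substT-num 0 (num k) b)))
        (inst-[] φ ρ (num k))
        (ax-∀E (num k)))
      (lift (α ∷ []) (num-≤ k≤b))
    where α = ∀' (leq (var 0) (num b) ⇒ inst φ (var 0 ∷ nums ρ))

  search : ∀ {P : ℕ → Set} {φ : ℕ → Formula} → (∀ k → Decided (P k) (φ k)) → ∀ b →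
    (∃ λ k → k ≤ b × P k × T ⊢ φ k) ⊎ (∀ k → k ≤ b → ¬ P k × T ⊢ ¬' (φ k))
  search d zero with d 0
  ... | holds p q = inj₁ (0 , z≤n , p , q)
  ... | fails p q = inj₂ λ { 0 z≤n → p , q }
  search d (suc b) with d (suc b) | search d b
  ... | holds p q | _                    = inj₁ (suc b , ≤-refl , p , q)
  ... | fails p q | inj₁ (k , k≤b , r)   = inj₁ (k , m≤n⇒m≤1+n k≤b , r)
  ... | fails p q | inj₂ r               = inj₂ λ k k≤1+b → case-≤ k (m≤n⇒m<n∨m≡n k≤1+b)
    where
    case-≤ : ∀ k → k < suc b ⊎ k ≡ suc b → _
    case-≤ k (inj₁ (s≤s k≤b)) = r k k≤b
    case-≤ k (inj₂ refl)      = p , q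

  negate : ∀ {P φ} → Decided P φ → Decided (¬ P) (¬' φ)
  negate (holds p q)  = fails (λ ¬p → ¬p p) (app (_ ∷ []) (hyp₀ []) (lift (_ ∷ []) q))
  negate (fails ¬p q) = holds ¬p q

  decide : ∀ {n} (φ : Bounded n) (ρ : Vec ℕ n) → Decided (⟦ φ ⟧ ρ) (inst φ (nums ρ))
  decide `⊥ ρ = fails (λ ()) (hyp₀ [])
  decide (t `≡ u) ρ with ⟦ t ⟧ᵗ ρ ≟ ⟦ u ⟧ᵗ ρ
  ... | yes p = holds p (⊩-trans [] (eval t ρ) (⊩-sym [] (≡.subst (λ k → T ⊢ instᵗ u (nums ρ) ≐ num k) (sym p) (eval u ρ))))
  ... | no ¬p = fails ¬p (app (α ∷ []) (lift (α ∷ []) (num-≢ _ _ ¬p))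
                  (⊩-trans (α ∷ []) (lift (α ∷ []) (⊩-sym [] (eval t ρ))) (⊩-trans (α ∷ []) (hyp₀ []) (lift (α ∷ []) (eval u ρ)))))
    where α = instᵗ t (nums ρ) ≐ instᵗ u (nums ρ)
  decide (φ `∧ ψ) ρ with decide φ ρ | decide ψ ρ
  ... | holds p q  | holds p′ q′ = holds (p , p′) (∧-intro [] q q′)
  ... | fails ¬p q | _           = fails (λ r → ¬p (proj₁ r)) (∧-elim₁ (_ ∷ []) (hyp₀ []) ⨾ q)
  ... | _          | fails ¬p q  = fails (λ r → ¬p (proj₂ r)) (∧-elim₂ (_ ∷ []) (hyp₀ []) ⨾ q)
  decide (φ `∨ ψ) ρ with decide φ ρ | decide ψ ρ
  ... | holds p q  | _            = holds (inj₁ p) (exfalso (_ ∷ []) (app (_ ∷ []) (hyp₀ []) (lift (_ ∷ []) q)))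
  ... | _          | holds p q    = holds (inj₂ p) (lift (_ ∷ []) q)
  ... | fails ¬p q | fails ¬p′ q′ = fails (λ { (inj₁ p) → ¬p p ; (inj₂ p) → ¬p′ p })
                                      (app (_ ∷ []) (lift (_ ∷ []) q′) (app (_ ∷ []) (hyp₀ []) (lift (_ ∷ []) q)))
  decide (φ `⇒ ψ) ρ with decide φ ρ | decide ψ ρ
  ... | fails ¬p q | _           = holds (λ p → ⊥-elim (¬p p)) (exfalso (_ ∷ []) q)
  ... | _          | holds p q   = holds (λ _ → p) (lift (_ ∷ []) q)
  ... | holds p q  | fails ¬p q′ = fails (λ r → ¬p (r p))
                                     (app (_ ∷ []) (lift (_ ∷ []) q′) (app (_ ∷ []) (hyp₀ []) (lift (_ ∷ []) q)))
  -- The search is for a counterexample. If there is none, the double negations are removed by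
  -- `ax-DN` inside `T` and by deciding the instance once more outside.
  decide (`∀≤ i φ) ρ rewrite inst-∀≤ i φ ρ with search (λ k → negate (decide φ (k ∷ ρ))) (lookup ρ i)
  ... | inj₁ (k , k≤b , ¬p , q) = fails (λ r → ¬p (r k k≤b)) (instance-upTo-num (lookup ρ i) φ ρ k≤b ⨾ q)
  ... | inj₂ r = holds (λ k k≤b → satisfied k (r k k≤b)) (gen (upTo-num (lookup ρ i) φ ρ (λ k k≤b → mp ax-DN (proj₂ (r k k≤b))) (var 0)))
    where
    satisfied : ∀ k → (¬ ¬ ⟦ φ ⟧ (k ∷ ρ)) × _ → ⟦ φ ⟧ (k ∷ ρ)
    satisfied k (¬¬p , _) with decide φ (k ∷ ρ)
    ... | holds p _  = p
    ... | fails ¬p _ = ⊥-elim (¬¬p ¬p)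
  decide (`∃≤ i φ) ρ rewrite inst-∃≤ i φ ρ with search (λ k → decide φ (k ∷ ρ)) (lookup ρ i)
  ... | inj₁ (k , k≤b , p , q) = holds (k , k≤b , p) (mp (∃-intro (num k)) (≡.subst₂ (λ α β → T ⊢ α ∧' β)
        (sym (trans (subst-leq 0 (num k) (var 0) (num b)) (cong (leq (num k)) (substT-num 0 (num k) b))))
        (sym (inst-[] φ ρ (num k)))
        (∧-intro [] (num-≤ k≤b) q)))
    where b = lookup ρ i
  ... | inj₂ r = fails (λ { (k , k≤b , p) → proj₁ (r k k≤b) p }) (∃-elim
        (app (_ ∷ []) (∧-elim₁ (_ ∷ []) (hyp₀ []) ⨾ upTo-num (lookup ρ i) (φ `⇒ `⊥) ρ (λ k k≤b → proj₂ (r k k≤b)) (var 0))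
                      (∧-elim₂ (_ ∷ []) (hyp₀ []))))

  true⇒⊢ : ∀ {n} (φ : Bounded n) ρ → ⟦ φ ⟧ ρ → T ⊢ inst φ (nums ρ)
  true⇒⊢ φ ρ p with decide φ ρ
  ... | holds _ q  = q
  ... | fails ¬p _ = ⊥-elim (¬p p)

-- Coding of trees and finite sets

-- A pairing (a , b) ↦ g (a + b) + b is injective when the blocks [g s , g s + s] are disjoint and increasing.
module Blocks (g : ℕ → ℕ) (g-step : ∀ s → g s + s < g (suc s)) where

  mono : ∀ {s} u → s ≤ u → g s ≤ g u
  mono {s} zero    z≤n   = ≤-refl
  mono {s} (suc u) s≤1+u with m≤n⇒m<n∨m≡n s≤1+u
  ... | inj₁ (s≤s s≤u) = ≤-trans (mono u s≤u) (≤-trans (m≤m+n (g u) u) (<⇒≤ (g-step u)))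
  ... | inj₂ refl      = ≤-refl

  separated : ∀ {s u b c} → b ≤ s → s < u → g s + b < g u + c
  separated {s} {u} {b} {c} b≤s s<u = begin-strict
    g s + b   ≤⟨ +-monoʳ-≤ (g s) b≤s ⟩
    g s + s   <⟨ g-step s ⟩
    g (suc s) ≤⟨ mono u s<u ⟩
    g u       ≤⟨ m≤m+n (g u) c ⟩
    g u + c   ∎
    where open ≤-Reasoning

  injective : ∀ a b c d → g (a + b) + b ≡ g (c + d) + d → a ≡ c × b ≡ d
  injective a b c d eq with <-cmp (a + b) (c + d)
  ... | tri< lt _ _ = ⊥-elim (<⇒≢ (separated (m≤n+m b a) lt) eq)
  ... | tri> _ _ gt = ⊥-elim (<⇒≢ (separated (m≤n+m d c) gt) (sym eq))
  ... | tri≈ _ s≡u _ = +-cancelʳ-≡ b a c (trans s≡u (cong (c +_) (sym b≡d))) , b≡d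
    where
    b≡d : b ≡ d
    b≡d = +-cancelˡ-≡ (g (a + b)) b d (trans eq (cong (λ s → g s + d) (sym s≡u)))

-- The triangular number s (s + 1) / 2, as it occurs in `pair`.
half : ℕ → ℕ
half s = ⌊ s * suc s /2⌋

-- The argument of the floor grows by the even number 2 (s + 1), so no rounding interferes. This
-- recurrence is what the rule `tri-suc` computes with.
half-suc : ∀ s → half (suc s) ≡ half s + suc s
half-suc s = trans (cong ⌊_/2⌋ double) (⌊+2k/2⌋ (s * suc s) (suc s))
  where
  ⌊+2k/2⌋ : ∀ m k → ⌊ m + (k + k) /2⌋ ≡ ⌊ m /2⌋ + k
  ⌊+2k/2⌋ m zero    = trans (cong ⌊_/2⌋ (+-identityʳ m)) (sym (+-identityʳ _))
  ⌊+2k/2⌋ m (suc k) rewrite +-suc k k | +-suc m (suc (k + k)) | +-suc m (k + k) | +-suc ⌊ m /2⌋ k = cong suc (⌊+2k/2⌋ m k)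
  double : suc s * suc (suc s) ≡ s * suc s + (suc s + suc s)
  double = trans (*-comm (suc s) (suc (suc s))) (trans (sym (+-assoc (suc s) (suc s) (s * suc s))) (+-comm (suc s + suc s) (s * suc s)))

pair-injective : ∀ a b c d → pair a b ≡ pair c d → a ≡ c × b ≡ d
pair-injective = Blocks.injective half (λ s → ≤-reflexive (sym (trans (half-suc s) (+-suc (half s) s))))

opaque
  -- Unlike Cantor's pairing, this one is a polynomial over ℕ.
  J : ℕ → ℕ → ℕ
  J a b = (a + b) * (a + b) + b

  J-def : ∀ a b → J a b ≡ (a + b) * (a + b) + b
  J-def a b = refl

  J-injective : ∀ a b c d → J a b ≡ J c d → a ≡ c × b ≡ d
  J-injective = Blocks.injective (λ s → s * s) (λ s → s≤s (begin
      s * s + s       ≡⟨ +-comm (s * s) s ⟩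
      s + s * s       ≡⟨ sym (*-suc s s) ⟩
      s * suc s       ≤⟨ m≤n+m (s * suc s) s ⟩
      s + s * suc s   ∎))
    where open ≤-Reasoning

  J-0-0 : J 0 0 ≡ 0
  J-0-0 = refl

  ≤J₁ : ∀ a b → a ≤ J a b
  ≤J₁ zero    b = z≤n
  ≤J₁ (suc a) b = ≤-trans (≤-trans (m≤m+n (suc a) b) (m≤m*n (suc a + b) (suc a + b))) (m≤m+n _ b)

  ≤J₂ : ∀ a b → b ≤ J a b
  ≤J₂ a b = m≤n+m b _

  J-mono : ∀ {a b c d} → a ≤ c → b ≤ d → J a b ≤ J c d
  J-mono a≤c b≤d = +-mono-≤ (*-mono-≤ (+-mono-≤ a≤c b≤d) (+-mono-≤ a≤c b≤d)) b≤d

  -- Strictness fails at J 0 0 = 0. Nodes have a first component of at least 2, so decoding them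
  -- descends.
  <J₂ : ∀ a b → b < J (suc a) b
  <J₂ a b = s≤s (m≤n+m b _)

-- Trees over variables of type V, with constant tags and labels of type N at the leaves.
data Tree (V N : Set) : Set where
  tv : V → Tree V N
  tg : ℕ → Tree V N
  lf : N → Tree V N
  nd : Tree V N → Tree V N → Tree V N

Ground : Set
Ground = Tree ⊥ ℕ

Pattern : ℕ → Set
Pattern k = Tree (Fin k) (Tm k)

-- The first component of `J` separates the constructors: 0, 1, and at least 2.
code : Ground → ℕ
code (tg k)   = J 0 k
code (lf n)   = J 1 n
code (nd s t) = J (2 + code s) (code t)

-- A tree variable takes a number as the code itself, whether or not that number codes a tree. Hence
-- rule instances range over plain vectors of numbers, which a bounded formula can quantify over.
codeAt : ∀ {k} → Vec ℕ k → Pattern k → ℕ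
codeAt ρ (tv i)   = lookup ρ i
codeAt ρ (tg k)   = J 0 k
codeAt ρ (lf t)   = J 1 (⟦ t ⟧ᵗ ρ)
codeAt ρ (nd P R) = J (2 + codeAt ρ P) (codeAt ρ R)

`num : ∀ {n} → ℕ → Tm n
`num zero    = `0
`num (suc k) = `suc (`num k)

`J : ∀ {n} → Tm n → Tm n → Tm n
`J t u = (t `+ u) `* (t `+ u) `+ u

codeTm : ∀ {k} → Pattern k → Tm k
codeTm (tv i)   = ` i
codeTm (tg k)   = `J `0 (`num k)
codeTm (lf t)   = `J (`suc `0) t
codeTm (nd P R) = `J (`suc (`suc (codeTm P))) (codeTm R)

⟦`num⟧ : ∀ {n} k (ρ : Vec ℕ n) → ⟦ `num k ⟧ᵗ ρ ≡ k
⟦`num⟧ zero    ρ = refl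
⟦`num⟧ (suc k) ρ = cong suc (⟦`num⟧ k ρ)

⟦`J⟧ : ∀ {n a b} (t u : Tm n) ρ → ⟦ t ⟧ᵗ ρ ≡ a → ⟦ u ⟧ᵗ ρ ≡ b → ⟦ `J t u ⟧ᵗ ρ ≡ J a b
⟦`J⟧ t u ρ refl refl = sym (J-def _ _)

⟦codeTm⟧ : ∀ {k} (P : Pattern k) ρ → ⟦ codeTm P ⟧ᵗ ρ ≡ codeAt ρ P
⟦codeTm⟧ (tv i)   ρ = refl
⟦codeTm⟧ (tg k)   ρ = ⟦`J⟧ `0 (`num k) ρ refl (⟦`num⟧ k ρ)
⟦codeTm⟧ (lf t)   ρ = ⟦`J⟧ (`suc `0) t ρ refl refl
⟦codeTm⟧ (nd P R) ρ = ⟦`J⟧ (`suc (`suc (codeTm P))) (codeTm R) ρ (cong (2 +_) (⟦codeTm⟧ P ρ)) (⟦codeTm⟧ R ρ)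

embed : ∀ {k} → Ground → Pattern k
embed (tg k)   = tg k
embed (lf n)   = lf (`num n)
embed (nd s t) = nd (embed s) (embed t)

codeAt-embed : ∀ {k} (ρ : Vec ℕ k) t → codeAt ρ (embed t) ≡ code t
codeAt-embed ρ (tg k)   = refl
codeAt-embed ρ (lf n)   = cong (J 1) (⟦`num⟧ n ρ)
codeAt-embed ρ (nd s t) = cong₂ (λ a b → J (2 + a) b) (codeAt-embed ρ s) (codeAt-embed ρ t)

-- Numbers that are not codes decode to junk; only the behaviour on values of J matters.

J-image? : ∀ n → Dec (∃ λ a → a < suc n × ∃ λ b → b < suc n × J a b ≡ n)
J-image? n = anyUpTo? (λ a → anyUpTo? (λ b → J a b ≟ n) (suc n)) (suc n)

split : ℕ → ℕ × ℕ
split n with J-image? n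
... | yes (a , _ , b , _) = a , b
-- This default satisfies J a b ≤ n for every n, so the bound on the components holds for numbers
-- outside the image of `J` as well.
... | no _                = 0 , 0

split-J : ∀ a b → split (J a b) ≡ (a , b)
split-J a b with J-image? (J a b)
... | yes (c , _ , d , _ , eq) with J-injective c d a b eq
...   | refl , refl = refl
split-J a b | no none = ⊥-elim (none (a , s≤s (≤J₁ a b) , b , s≤s (≤J₂ a b) , refl))

J-split-≤ : ∀ n → J (proj₁ (split n)) (proj₂ (split n)) ≤ n
J-split-≤ n with J-image? n
... | yes (a , _ , b , _ , eq) = ≤-reflexive eq
... | no _                     = ≤-trans (≤-reflexive J-0-0) z≤n

-- The first argument is fuel. Components of a node are smaller than its code, so `n` units suffice
-- for `n`.
decode-within : ℕ → ℕ → Ground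
decode-split : ℕ → ℕ × ℕ → Ground
-- At n = 0 this agrees with the decoding of 0 = J 0 0 under positive fuel, which makes the result
-- independent of the fuel.
decode-within zero    n = tg 0
decode-within (suc f) n = decode-split f (split n)
decode-split f (0 , b)           = tg b
decode-split f (1 , b)           = lf b
decode-split f (suc (suc a) , b) = nd (decode-within f a) (decode-within f b)

decode : ℕ → Ground
decode n = decode-within n n

decode-within-irrelevant : ∀ f g n → n ≤ f → n ≤ g → decode-within f n ≡ decode-within g n
decode-within-irrelevant zero    zero    n    _   _ = refl
decode-within-irrelevant zero    (suc g) zero _   _
  rewrite ≡.subst (λ n → split n ≡ (0 , 0)) J-0-0 (split-J 0 0) = refl
decode-within-irrelevant (suc f) zero    zero _   _
  rewrite ≡.subst (λ n → split n ≡ (0 , 0)) J-0-0 (split-J 0 0) = refl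
decode-within-irrelevant (suc f) (suc g) n    n≤f n≤g with split n | J-split-≤ n
... | 0 , b           | _   = refl
... | 1 , b           | _   = refl
... | suc (suc a) , b | J≤n = cong₂ nd
      (decode-within-irrelevant f g a (below n≤f a<n) (below n≤g a<n))
      (decode-within-irrelevant f g b (below n≤f b<n) (below n≤g b<n))
  where
  a<n : a < n
  a<n = ≤-trans (≤-trans (n≤1+n (suc a)) (≤J₁ (suc (suc a)) b)) J≤n
  b<n : b < n
  b<n = ≤-trans (<J₂ (suc a) b) J≤n
  below : ∀ {x h} → n ≤ suc h → x < n → x ≤ h
  below n≤1+h x<n = ≤-pred (≤-trans x<n n≤1+h)

decode-unfold : ∀ n → decode n ≡ decode-split n (split n)
decode-unfold n = decode-within-irrelevant n (suc n) n ≤-refl (n≤1+n n)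

decode-tg : ∀ k → decode (J 0 k) ≡ tg k
decode-tg k = trans (decode-unfold (J 0 k)) (cong (decode-split (J 0 k)) (split-J 0 k))

decode-lf : ∀ n → decode (J 1 n) ≡ lf n
decode-lf n = trans (decode-unfold (J 1 n)) (cong (decode-split (J 1 n)) (split-J 1 n))

decode-nd : ∀ a b → decode (J (2 + a) b) ≡ nd (decode a) (decode b)
decode-nd a b = trans (decode-unfold n) (trans (cong (decode-split n) (split-J (2 + a) b)) (cong₂ nd
    (decode-within-irrelevant n a a (≤-trans (m≤n+m a 2) (≤J₁ (2 + a) b)) ≤-refl)
    (decode-within-irrelevant n b b (≤J₂ (2 + a) b) ≤-refl)))
  where n = J (2 + a) b

treeAt : ∀ {k} → Vec ℕ k → Pattern k → Ground
treeAt ρ (tv i)   = decode (lookup ρ i)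
treeAt ρ (tg k)   = tg k
treeAt ρ (lf t)   = lf (⟦ t ⟧ᵗ ρ)
treeAt ρ (nd P R) = nd (treeAt ρ P) (treeAt ρ R)

decode-codeAt : ∀ {k} (ρ : Vec ℕ k) P → decode (codeAt ρ P) ≡ treeAt ρ P
decode-codeAt ρ (tv i)   = refl
decode-codeAt ρ (tg k)   = decode-tg k
decode-codeAt ρ (lf t)   = decode-lf (⟦ t ⟧ᵗ ρ)
decode-codeAt ρ (nd P R) = trans (decode-nd _ _) (cong₂ nd (decode-codeAt ρ P) (decode-codeAt ρ R))

treeAt-embed : ∀ {k} (ρ : Vec ℕ k) t → treeAt ρ (embed t) ≡ t
treeAt-embed ρ (tg k)   = refl
treeAt-embed ρ (lf n)   = cong lf (⟦`num⟧ n ρ)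
treeAt-embed ρ (nd s t) = cong₂ nd (treeAt-embed ρ s) (treeAt-embed ρ t)

-- A finite set L of numbers ≤ N is coded by d = N! and c = ∏ (1 + (1 + e) d) over e ∈ L: these factors are pairwise coprime.

factor : ℕ → ℕ → ℕ
factor d e = suc (suc e * d)

∣factor∧∣d⇒≡1 : ∀ {g} d e → g ∣ factor d e → g ∣ d → g ≡ 1
∣factor∧∣d⇒≡1 {g} d e g∣f g∣d = ∣1⇒≡1 (∣m+n∣m⇒∣n (≡.subst (g ∣_) (+-comm 1 (suc e * d)) g∣f) (∣n⇒∣m*n (suc e) g∣d))

-- A common divisor divides the difference (k + 1) d. It is coprime to d, since the factors are 1
-- modulo d, so it divides k + 1, hence d, hence is 1.
factor-coprime-< : ∀ d e k → suc k ∣ d → Coprime (factor d e) (factor d (suc e + k))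
factor-coprime-< d e k 1+k∣d {g} (g∣e , g∣e+k) = ∣factor∧∣d⇒≡1 d e g∣e (∣-trans g∣1+k 1+k∣d)
  where
  difference : factor d (suc e + k) ≡ factor d e + d * suc k
  difference = cong suc (trans (cong (_* d) (sym (+-suc (suc e) k)))
    (trans (*-distribʳ-+ d (suc e) (suc k)) (cong (suc e * d +_) (*-comm (suc k) d))))
  g∣1+k : g ∣ suc k
  g∣1+k = coprime-divisor {g} {d} (λ { (h∣g , h∣d) → ∣factor∧∣d⇒≡1 d e (∣-trans h∣g g∣e) h∣d })
            (∣m+n∣m⇒∣n (≡.subst (g ∣_) difference g∣e+k) g∣e)

suc∣! : ∀ {k N} → suc k ≤ N → suc k ∣ N !
suc∣! {k} 1+k≤N = ∣-trans (m∣m*n (k !)) (m≤n⇒m!∣n! 1+k≤N)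

factor-coprime : ∀ N {e e′} → e ≤ N → e′ ≤ N → e ≢ e′ → Coprime (factor (N !) e) (factor (N !) e′)
factor-coprime N {e} {e′} e≤N e′≤N e≢e′ with <-cmp e e′
... | tri≈ _ e≡e′ _ = ⊥-elim (e≢e′ e≡e′)
... | tri< e<e′ _ _ with k , refl ← m≤n⇒∃[o]m+o≡n e<e′ =
  factor-coprime-< (N !) e k (suc∣! (≤-trans (s≤s (m≤n+m k e)) e′≤N))
... | tri> _ _ e′<e with k , refl ← m≤n⇒∃[o]m+o≡n e′<e =
  λ (p , q) → factor-coprime-< (N !) e′ k (suc∣! (≤-trans (s≤s (m≤n+m k e′)) e≤N)) (q , p)

setCode : ℕ → List ℕ → ℕ
setCode d L = product (List.map (factor d) L)

∈⇒factor∣ : ∀ d {e L} → e ∈ L → factor d e ∣ setCode d L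
∈⇒factor∣ d e∈L = ∈⇒∣product (∈-map⁺ (factor d) e∈L)

-- The factor of `e` is coprime to that of any other element, so each such factor can be cancelled
-- from the product until `e` itself is met.
factor∣⇒∈ : ∀ N L → (∀ {e} → e ∈ L → e ≤ N) → ∀ {e} → e ≤ N → factor (N !) e ∣ setCode (N !) L → e ∈ L
-- The empty product is 1, whereas the factor exceeds 1 because N! is positive.
factor∣⇒∈ N []      L≤N {e} e≤N f∣1 = ⊥-elim (m<n⇒n≢0 (m≤n⇒m≤n+o (e * N !) (1≤n! N)) (suc-injective (∣1⇒≡1 f∣1)))
factor∣⇒∈ N (x ∷ L) L≤N {e} e≤N f∣  with e ≟ x
... | yes refl = here refl
... | no e≢x   = there (factor∣⇒∈ N L (λ p → L≤N (there p)) e≤N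
                   (coprime-divisor (factor-coprime N e≤N (L≤N (here refl)) e≢x) f∣))

-- Arithmetisation of Horn systems

renᵗ : ∀ {m n} → (Fin m → Fin n) → Tm m → Tm n
renᵗ f (` i)    = ` f i
renᵗ f `0       = `0
renᵗ f (`suc t) = `suc (renᵗ f t)
renᵗ f (t `+ u) = renᵗ f t `+ renᵗ f u
renᵗ f (t `* u) = renᵗ f t `* renᵗ f u

⟦renᵗ⟧ : ∀ {m n} (f : Fin m → Fin n) {ρ σ} → (∀ i → lookup σ (f i) ≡ lookup ρ i) → ∀ t → ⟦ renᵗ f t ⟧ᵗ σ ≡ ⟦ t ⟧ᵗ ρ
⟦renᵗ⟧ f eq (` i)    = eq i
⟦renᵗ⟧ f eq `0       = refl
⟦renᵗ⟧ f eq (`suc t) = cong suc (⟦renᵗ⟧ f eq t)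
⟦renᵗ⟧ f eq (t `+ u) = cong₂ _+_ (⟦renᵗ⟧ f eq t) (⟦renᵗ⟧ f eq u)
⟦renᵗ⟧ f eq (t `* u) = cong₂ _*_ (⟦renᵗ⟧ f eq t) (⟦renᵗ⟧ f eq u)

⋀ ⋁ : ∀ {n} → List (Bounded n) → Bounded n
⋀ = List.foldr _`∧_ (`0 `≡ `0)
⋁ = List.foldr _`∨_ `⊥

module _ {A : Set} {n} {f : A → Bounded n} {ρ : Vec ℕ n} where

  ⋀-intro : ∀ {xs} → All (λ x → ⟦ f x ⟧ ρ) xs → ⟦ ⋀ (List.map f xs) ⟧ ρ
  ⋀-intro []       = refl
  ⋀-intro (p ∷ ps) = p , ⋀-intro ps

  ⋀-elim : ∀ xs → ⟦ ⋀ (List.map f xs) ⟧ ρ → All (λ x → ⟦ f x ⟧ ρ) xs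
  ⋀-elim []       _        = []
  ⋀-elim (x ∷ xs) (p , ps) = p ∷ ⋀-elim xs ps

  ⋁-intro : ∀ {x xs} → x ∈ xs → ⟦ f x ⟧ ρ → ⟦ ⋁ (List.map f xs) ⟧ ρ
  ⋁-intro (here refl)  p = inj₁ p
  ⋁-intro (there x∈xs) p = inj₂ (⋁-intro x∈xs p)

  ⋁-elim : ∀ xs → ⟦ ⋁ (List.map f xs) ⟧ ρ → ∃ λ x → ⟦ f x ⟧ ρ
  ⋁-elim (x ∷ xs) (inj₁ p) = x , p
  ⋁-elim (x ∷ xs) (inj₂ p) = ⋁-elim xs p

`∃≤* : ∀ k {m} → Fin m → Bounded (k + m) → Bounded m
`∃≤* zero    i φ = φ
`∃≤* (suc k) i φ = `∃≤* k i (`∃≤ (k ↑ʳ i) φ)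

`∃≤*-intro : ∀ {k m} i (φ : Bounded (k + m)) (xs : Vec ℕ k) {ρ} → (∀ j → lookup xs j ≤ lookup ρ i) →
  ⟦ φ ⟧ (xs Vec.++ ρ) → ⟦ `∃≤* k i φ ⟧ ρ
`∃≤*-intro i φ []       xs≤ p = p
`∃≤*-intro i φ (x ∷ xs) {ρ} xs≤ p = `∃≤*-intro i (`∃≤ (_ ↑ʳ i) φ) xs (λ j → xs≤ (suc j))
  (x , ≤-trans (xs≤ zero) (≤-reflexive (sym (lookup-++ʳ xs ρ i))) , p)

`∃≤*-elim : ∀ k {m} i (φ : Bounded (k + m)) {ρ} → ⟦ `∃≤* k i φ ⟧ ρ →
  Σ (Vec ℕ k) λ xs → (∀ j → lookup xs j ≤ lookup ρ i) × ⟦ φ ⟧ (xs Vec.++ ρ)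
`∃≤*-elim zero    i φ p = [] , (λ ()) , p
`∃≤*-elim (suc k) i φ {ρ} p with `∃≤*-elim k i (`∃≤ (k ↑ʳ i) φ) p
... | xs , xs≤ , x , x≤ , q = x ∷ xs ,
  (λ { zero → ≤-trans x≤ (≤-reflexive (lookup-++ʳ xs ρ i)) ; (suc j) → xs≤ j }) , q

-- ⟨ r , n ⟩ belongs to the finite set coded by c and d.
member : ∀ {m} (r n c d : Fin m) → Bounded m
member r n c d = `∃≤ c (` zero `* `suc (`suc (`J (` suc r) (` suc n)) `* ` suc d) `≡ ` suc c)

Member : (c d r n : ℕ) → Set
Member c d r n = factor d (J r n) ∣ c

member-intro : ∀ {m} (r n c d : Fin m) ρ → Member (lookup ρ c) (lookup ρ d) (lookup ρ r) (lookup ρ n) → ⟦ member r n c d ⟧ ρ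
member-intro r n c d ρ (divides q c≡qf) =
  -- The factor is positive, so the quotient is at most the dividend `c`, which is the bound in the
  -- formula.
  q , ≤-trans (m≤m*n q (factor (lookup ρ d) (J (lookup ρ r) (lookup ρ n)))) (≤-reflexive (sym c≡qf)) ,
  trans (cong (λ e → q * factor (lookup ρ d) e) (sym (J-def (lookup ρ r) (lookup ρ n)))) (sym c≡qf)

member-elim : ∀ {m} (r n c d : Fin m) ρ → ⟦ member r n c d ⟧ ρ → Member (lookup ρ c) (lookup ρ d) (lookup ρ r) (lookup ρ n)
member-elim r n c d ρ (q , _ , eq) =
  divides q (trans (sym eq) (cong (λ e → q * factor (lookup ρ d) e) (sym (J-def (lookup ρ r) (lookup ρ n)))))

infix 0 _⊣_
record Clause (k : ℕ) : Set where
  constructor _⊣_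
  field
    head : Pattern k
    body : List (Pattern k)

open Clause

module Horn {k : ℕ} {Rule : Set} (clause : Rule → Clause k) (rules : List Rule) (∈rules : ∀ s → s ∈ rules) where

  data Derivable : ℕ → Set where
    by-rule : ∀ s ρ → All (λ P → Derivable (codeAt ρ P)) (body (clause s)) → Derivable (codeAt ρ (head (clause s)))

  module _ (M : Ground → Set)
           (M-closed : ∀ s ρ → All (λ P → M (treeAt ρ P)) (body (clause s)) → M (treeAt ρ (head (clause s)))) where

    sound : ∀ {n} → Derivable n → M (decode n)
    sound-all : ∀ ρ Ps → All (λ P → Derivable (codeAt ρ P)) Ps → All (λ P → M (treeAt ρ P)) Ps
    sound (by-rule s ρ ps) = ≡.subst M (sym (decode-codeAt ρ (head (clause s)))) (M-closed s ρ (sound-all ρ _ ps))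
    sound-all ρ []       []       = []
    sound-all ρ (P ∷ Ps) (p ∷ ps) = ≡.subst M (decode-codeAt ρ P) (sound p) ∷ sound-all ρ Ps ps

  -- Any stage up to `r` is allowed because the derivations of different premises have different
  -- heights.
  Premise : (ℕ → ℕ → Set) → (b r : ℕ) → Vec ℕ k → Pattern k → Set
  Premise X b r ρ P = ∃ λ r′ → r′ ≤ r × codeAt ρ P ≤ b × X r′ (codeAt ρ P)

  -- X r n reads: n is derived at stage r. A fact is justified when its premises occur at earlier stages,
  -- all numbers involved being bounded by b.
  Justified : (ℕ → ℕ → Set) → (b r n : ℕ) → Set
  Justified X b r n = ∃ λ r₀ → r ≡ suc r₀ × Σ (Vec ℕ k) λ ρ → (∀ i → lookup ρ i ≤ b) ×
    ∃ λ s → n ≡ codeAt ρ (head (clause s)) × All (Premise X b r₀ ρ) (body (clause s))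

  module _ {X Y : ℕ → ℕ → Set} (X⊆Y : ∀ {r n} → X r n → Y r n) where

    Premise-mono : ∀ {b b′ r r′} ρ {Ps} → b ≤ b′ → r ≤ r′ → All (Premise X b r ρ) Ps → All (Premise Y b′ r′ ρ) Ps
    Premise-mono ρ b≤b′ r≤r′ [] = []
    Premise-mono ρ b≤b′ r≤r′ ((q , q≤r , P≤b , x) ∷ ps) =
      (q , ≤-trans q≤r r≤r′ , ≤-trans P≤b b≤b′ , X⊆Y x) ∷ Premise-mono ρ b≤b′ r≤r′ ps

    Justified-mono : ∀ {b b′ r n} → b ≤ b′ → Justified X b r n → Justified Y b′ r n
    Justified-mono b≤b′ (r₀ , eq , ρ , ρ≤b , s , eq′ , ps) =
      r₀ , eq , ρ , (λ i → ≤-trans (ρ≤b i) b≤b′) , s , eq′ , Premise-mono ρ b≤b′ ≤-refl ps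

  Closed : (ℕ → ℕ → Set) → ℕ → Set
  Closed X b = ∀ r n → r ≤ b → n ≤ b → X r n → Justified X b r n

  -- Stages drop strictly from a fact to its premises, so circular justification is impossible and
  -- recursion on a bound of the stage terminates. `X` is arbitrary: numbers `c` and `d` that code
  -- no intended set do no harm.
  closed⇒derivable : ∀ {X b} → Closed X b → ∀ r′ r n → r ≤ r′ → r ≤ b → n ≤ b → X r n → Derivable n
  closed⇒derivable X-closed r′ r n r≤r′ r≤b n≤b x with X-closed r n r≤b n≤b x
  closed⇒derivable {X} {b} X-closed (suc r′) .(suc r₀) n (s≤s r₀≤r′) r≤b n≤b x | r₀ , refl , ρ , _ , s , refl , ps =
    by-rule s ρ (All.map (λ (q , q≤r₀ , P≤b , x′) →
      closed⇒derivable {X} X-closed r′ q _ (≤-trans q≤r₀ r₀≤r′) (≤-trans q≤r₀ (≤-trans (n≤1+n r₀) r≤b)) P≤b x′) ps)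

  InList : List (ℕ × ℕ) → ℕ → ℕ → Set
  InList L r n = (r , n) ∈ L

  ClosedList : List (ℕ × ℕ) → ℕ → Set
  ClosedList L b = ∀ {r n} → (r , n) ∈ L → r ≤ b × n ≤ b × Justified (InList L) b r n

  ClosedList-++ : ∀ {L L′ b b′} → ClosedList L b → ClosedList L′ b′ → ClosedList (L List.++ L′) (b ⊔ b′)
  ClosedList-++ {L} {L′} {b} {b′} cl cl′ x with ∈-++⁻ L x
  ... | inj₁ y = let r≤ , n≤ , j = cl y in
    ≤-trans r≤ (m≤m⊔n b b′) , ≤-trans n≤ (m≤m⊔n b b′) , Justified-mono {InList L} {InList (L List.++ L′)} ∈-++⁺ˡ (m≤m⊔n b b′) j
  ... | inj₂ y = let r≤ , n≤ , j = cl′ y in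
    ≤-trans r≤ (m≤n⊔m b b′) , ≤-trans n≤ (m≤n⊔m b b′) , Justified-mono {InList L′} {InList (L List.++ L′)} (∈-++⁺ʳ L) (m≤n⊔m b b′) j

  entries-bound : ∀ {m} (ρ : Vec ℕ m) → ∃ λ b → ∀ i → lookup ρ i ≤ b
  entries-bound []      = 0 , λ ()
  entries-bound (x ∷ ρ) = let b , ρ≤b = entries-bound ρ in
    x ⊔ b , λ { zero → m≤m⊔n x b ; (suc i) → ≤-trans (ρ≤b i) (m≤n⊔m x b) }

  -- The list collects the facts of the derivation tree, each with its height as stage; the bound is
  -- a maximum over all stages, facts and rule instances in it.
  derivable⇒list : ∀ {n} → Derivable n → ∃ λ L → ∃ λ b → ∃ λ r → ClosedList L b × (r , n) ∈ L
  derivables⇒list : ∀ ρ Ps → All (λ P → Derivable (codeAt ρ P)) Ps →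
    ∃ λ L → ∃ λ b → ∃ λ r → ClosedList L b × All (Premise (InList L) b r ρ) Ps

  derivable⇒list (by-rule s ρ ps) =
    let L , b , r , cl , prems = derivables⇒list ρ _ ps
        e , ρ≤e = entries-bound ρ
        n = codeAt ρ (head (clause s))
        b′ = (suc r ⊔ n) ⊔ (e ⊔ b)
        b≤b′ : b ≤ b′
        b≤b′ = ≤-trans (m≤n⊔m e b) (m≤n⊔m (suc r ⊔ n) (e ⊔ b))
        e≤b′ : e ≤ b′
        e≤b′ = ≤-trans (m≤m⊔n e b) (m≤n⊔m (suc r ⊔ n) (e ⊔ b))
        L′ = (suc r , n) ∷ L
        closed : ClosedList L′ b′
        closed = λ
          { (here refl) → ≤-trans (m≤m⊔n (suc r) n) (m≤m⊔n _ (e ⊔ b)) , ≤-trans (m≤n⊔m (suc r) n) (m≤m⊔n _ (e ⊔ b)) ,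
              r , refl , ρ , (λ i → ≤-trans (ρ≤e i) e≤b′) , s , refl , Premise-mono {InList L} {InList L′} there ρ b≤b′ ≤-refl prems
          ; (there x) → let r≤ , n≤ , j = cl x in ≤-trans r≤ b≤b′ , ≤-trans n≤ b≤b′ , Justified-mono {InList L} {InList L′} there b≤b′ j }
    in L′ , b′ , suc r , (λ {r} {n} → closed {r} {n}) , here refl

  derivables⇒list ρ []       []       = [] , 0 , 0 , (λ ()) , []
  derivables⇒list ρ (P ∷ Ps) (p ∷ ps) with derivable⇒list p | derivables⇒list ρ Ps ps
  ... | L , b , r , cl , x | L′ , b′ , r′ , cl′ , prems =
    L List.++ L′ , b ⊔ b′ , r ⊔ r′ , ClosedList-++ cl cl′ ,
    (r , m≤m⊔n r r′ , ≤-trans (proj₁ (proj₂ (cl x))) (m≤m⊔n b b′) , ∈-++⁺ˡ x) ∷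
    Premise-mono {InList L′} {InList (L List.++ L′)} (∈-++⁺ʳ L) ρ (m≤n⊔m b b′) (m≤n⊔m r r′) prems

  -- Environments, innermost variable first:
  --   clause variables ++ r₀ ∷ n ∷ r ∷ d ∷ c ∷ b ∷ p ∷ x ∷ [].

  premise : Pattern k → Bounded (k + 8)
  premise P = `∃≤ (k ↑ʳ # 0) (`∃≤ (suc (k ↑ʳ # 5))
    (` # 0 `≡ renᵗ (λ i → suc (suc (i ↑ˡ 8))) (codeTm P)
      `∧ member (# 1) (# 0) (suc (suc (k ↑ʳ # 4))) (suc (suc (k ↑ʳ # 3)))))

  justified-by : Rule → Bounded (k + 8)
  justified-by s = ` (k ↑ʳ # 1) `≡ renᵗ (_↑ˡ 8) (codeTm (head (clause s))) `∧ ⋀ (List.map premise (body (clause s)))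

  justified : Bounded 7
  justified = `∃≤ (# 1) (` # 2 `≡ `suc (` # 0) `∧ `∃≤* k (# 5) (⋁ (List.map justified-by rules)))

  closed : Bounded 5
  closed = `∀≤ (# 2) (`∀≤ (# 3) (member (# 1) (# 0) (# 3) (# 2) `⇒ justified))

  opaque
    -- For a concrete system this is a huge formula, hence opaque.
    derivable : Tm 1 → Bounded 2
    derivable t = `∃≤ (# 0) (`∃≤ (# 1) (`∃≤ (# 2)
      (`∃≤ (# 2) (`∃≤ (# 3) (` # 0 `≡ renᵗ (λ _ → # 6) t `∧ member (# 1) (# 0) (# 3) (# 2))) `∧ closed)))

  module _ (n r d c b p x : ℕ) where

    env : ℕ → Vec ℕ 8
    env r₀ = r₀ ∷ n ∷ r ∷ d ∷ c ∷ b ∷ p ∷ x ∷ []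

    ⟦ren-codeTm⟧ : ∀ {m} (f : Fin k → Fin m) {σ} ρ → (∀ i → lookup σ (f i) ≡ lookup ρ i) → ∀ P → ⟦ renᵗ f (codeTm P) ⟧ᵗ σ ≡ codeAt ρ P
    ⟦ren-codeTm⟧ f ρ eq P = trans (⟦renᵗ⟧ f eq (codeTm P)) (⟦codeTm⟧ P ρ)

    premise-intro : ∀ r₀ ρ {P} → Premise (Member c d) b r₀ ρ P → ⟦ premise P ⟧ (ρ Vec.++ env r₀)
    premise-intro r₀ ρ {P} (r′ , r′≤r₀ , P≤b , x′) =
      r′ , ≤-trans r′≤r₀ (≤-reflexive (sym (lookup-++ʳ ρ (env r₀) (# 0)))) ,
      codeAt ρ P , ≤-trans P≤b (≤-reflexive (sym (lookup-++ʳ ρ (env r₀) (# 5)))) ,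
      sym (⟦ren-codeTm⟧ _ ρ (lookup-++ˡ ρ (env r₀)) P) ,
      member-intro (# 1) (# 0) (suc (suc (k ↑ʳ # 4))) (suc (suc (k ↑ʳ # 3))) (codeAt ρ P ∷ r′ ∷ ρ Vec.++ env r₀)
        (≡.subst₂ (λ c d → Member c d r′ (codeAt ρ P)) (sym (lookup-++ʳ ρ (env r₀) (# 4))) (sym (lookup-++ʳ ρ (env r₀) (# 3))) x′)

    premise-elim : ∀ r₀ ρ {P} → ⟦ premise P ⟧ (ρ Vec.++ env r₀) → Premise (Member c d) b r₀ ρ P
    premise-elim r₀ ρ {P} (r′ , r′≤r₀ , m , m≤b , m≡ , x′)
      with refl ← trans m≡ (⟦ren-codeTm⟧ _ ρ (lookup-++ˡ ρ (env r₀)) P) =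
      r′ , ≤-trans r′≤r₀ (≤-reflexive (lookup-++ʳ ρ (env r₀) (# 0))) ,
      ≤-trans m≤b (≤-reflexive (lookup-++ʳ ρ (env r₀) (# 5))) ,
      ≡.subst₂ (λ c d → Member c d r′ (codeAt ρ P)) (lookup-++ʳ ρ (env r₀) (# 4)) (lookup-++ʳ ρ (env r₀) (# 3))
        (member-elim (# 1) (# 0) (suc (suc (k ↑ʳ # 4))) (suc (suc (k ↑ʳ # 3))) (codeAt ρ P ∷ r′ ∷ ρ Vec.++ env r₀) x′)

    justified-intro : r ≤ b → Justified (Member c d) b r n → ⟦ justified ⟧ (n ∷ r ∷ d ∷ c ∷ b ∷ p ∷ x ∷ [])
    justified-intro r≤b (r₀ , refl , ρ , ρ≤b , s , n≡ , ps) =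
      r₀ , n≤1+n r₀ , refl , `∃≤*-intro (# 5) _ ρ ρ≤b
        (⋁-intro {f = justified-by} (∈rules s)
          ( trans (lookup-++ʳ ρ (env r₀) (# 1)) (trans n≡ (sym (⟦ren-codeTm⟧ _ ρ (lookup-++ˡ ρ (env r₀)) (head (clause s)))))
          , ⋀-intro {f = premise} (All.map (λ {P} → premise-intro r₀ ρ {P}) ps)))

    justified-elim : ⟦ justified ⟧ (n ∷ r ∷ d ∷ c ∷ b ∷ p ∷ x ∷ []) → Justified (Member c d) b r n
    justified-elim (r₀ , _ , r≡ , q) with `∃≤*-elim k (# 5) _ q
    ... | ρ , ρ≤b , q′ with ⋁-elim {f = justified-by} rules q′
    ...   | s , n≡ , ps = r₀ , r≡ , ρ , ρ≤b , s ,
      trans (sym (lookup-++ʳ ρ (env r₀) (# 1))) (trans n≡ (⟦ren-codeTm⟧ _ ρ (lookup-++ˡ ρ (env r₀)) (head (clause s)))) ,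
      All.map (λ {P} → premise-elim r₀ ρ {P}) (⋀-elim {f = premise} (body (clause s)) ps)

  opaque
    unfolding derivable

    derivable-elim : ∀ t p x → ⟦ derivable t ⟧ (p ∷ x ∷ []) → Derivable (⟦ t ⟧ᵗ (x ∷ []))
    derivable-elim t p x (b , _ , c , _ , d , _ , (r , r≤b , n , n≤b , n≡ , n∈) , cl) =
      ≡.subst Derivable (trans n≡ (⟦renᵗ⟧ _ (λ { zero → refl }) t))
        (closed⇒derivable {Member c d} (λ r n r≤b n≤b n∈ →
            justified-elim n r d c b p x (cl r r≤b n n≤b (member-intro (# 1) (# 0) (# 3) (# 2) (n ∷ r ∷ d ∷ c ∷ b ∷ p ∷ x ∷ []) n∈)))
          r r n ≤-refl r≤b n≤b (member-elim (# 1) (# 0) (# 3) (# 2) (n ∷ r ∷ d ∷ c ∷ b ∷ p ∷ x ∷ []) n∈))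

  list⇒code : ∀ L b → (∀ {r n} → (r , n) ∈ L → r ≤ b × n ≤ b) → ∃ λ c → ∃ λ d →
    (∀ {r n} → (r , n) ∈ L → Member c d r n) × (∀ {r n} → r ≤ b → n ≤ b → Member c d r n → (r , n) ∈ L)
  list⇒code L b bounded = setCode (N !) L′ , N ! , (λ x → ∈⇒factor∣ (N !) (∈-map⁺ (uncurry J) x)) , back
    where
    -- By monotonicity of `J` this bounds the codes of all pairs with entries up to `b`, both those
    -- listed and those asked about.
    N = J b b
    L′ = List.map (uncurry J) L
    L′≤N : ∀ {e} → e ∈ L′ → e ≤ N
    L′≤N e∈L′ with ∈-map⁻ (uncurry J) e∈L′
    ... | (r , n) , x , refl = J-mono (proj₁ (bounded x)) (proj₂ (bounded x))
    back : ∀ {r n} → r ≤ b → n ≤ b → Member (setCode (N !) L′) (N !) r n → (r , n) ∈ L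
    back {r} {n} r≤b n≤b f∣c with ∈-map⁻ (uncurry J) (factor∣⇒∈ N L′ L′≤N (J-mono r≤b n≤b) f∣c)
    ... | (r′ , n′) , x , eq with refl , refl ← J-injective r n r′ n′ eq = x

  opaque
    unfolding derivable

    derivable-intro : ∀ t x → Derivable (⟦ t ⟧ᵗ (x ∷ [])) → ∃ λ p → ⟦ derivable t ⟧ (p ∷ x ∷ [])
    derivable-intro t x δ =
      let L , b , r , cl , n∈L = derivable⇒list δ
          c , d , to , from = list⇒code L b (λ y → proj₁ (cl y) , proj₁ (proj₂ (cl y)))
          -- The stage need only dominate the bound and the two numbers coding the set; all other
          -- quantifiers are bounded by these.
          p = b ⊔ (c ⊔ d)
          n = ⟦ t ⟧ᵗ (x ∷ [])
          r≤b , n≤b , _ = cl n∈L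
      in p , b , m≤m⊔n b (c ⊔ d) , c , ≤-trans (m≤m⊔n c d) (m≤n⊔m b (c ⊔ d)) , d , ≤-trans (m≤n⊔m c d) (m≤n⊔m b (c ⊔ d)) ,
        (r , r≤b , n , n≤b , sym (⟦renᵗ⟧ _ (λ { zero → refl }) t) ,
          member-intro (# 1) (# 0) (# 3) (# 2) (n ∷ r ∷ d ∷ c ∷ b ∷ p ∷ x ∷ []) (to n∈L)) ,
        (λ r r≤b n n≤b n∈ → justified-intro n r d c b p x r≤b (Justified-mono {InList L} {Member c d} to ≤-refl
          (proj₂ (proj₂ (cl (from r≤b n≤b (member-elim (# 1) (# 0) (# 3) (# 2) (n ∷ r ∷ d ∷ c ∷ b ∷ p ∷ x ∷ []) n∈)))))))

-- The Horn rules for provability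

-- Tags are reused: the sort of a subtree is determined by its position in a judgement.

pattern ZERO      = tg 0
pattern VAR n     = nd (tg 0) (lf n)
pattern SUC t     = nd (tg 1) t
pattern PLUS t u  = nd (tg 2) (nd t u)
pattern TIMES t u = nd (tg 3) (nd t u)

pattern FALSUM   = tg 0
pattern EQ t u   = nd (tg 0) (nd t u)
pattern IMP a b  = nd (tg 1) (nd a b)
pattern ALL a    = nd (tg 2) a
pattern NOT a    = IMP a FALSUM

pattern NIL       = tg 0
pattern CONS s t  = nd s t

pattern FZERO    = tg 0
pattern FSUC i   = nd (tg 0) i
pattern PZERO    = tg 0
pattern PSUC     = tg 1
pattern PROJ i   = nd (tg 0) i
pattern COMP p s = nd (tg 1) (nd p s)
pattern PREC p q = nd (tg 2) (nd p q)
pattern MU p     = nd (tg 3) p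

-- Triangular numbers get a judgement of their own because the halving in `pair` is not a term of
-- arithmetic and must be computed by recursion.
pattern TRI s t          = nd (tg 0) (nd (lf s) (lf t))
pattern PAIR i j n       = nd (tg 1) (nd (lf i) (nd (lf j) (lf n)))
pattern CODET n t        = nd (tg 2) (nd (lf n) t)
pattern CODEF n a        = nd (tg 3) (nd (lf n) a)
pattern SHIFTT i t u     = nd (tg 4) (nd (lf i) (nd t u))
pattern SHIFTF i a b     = nd (tg 5) (nd (lf i) (nd a b))
pattern SUBSTT i s t u   = nd (tg 6) (nd (lf i) (nd s (nd t u)))
pattern SUBSTF i s a b   = nd (tg 7) (nd (lf i) (nd s (nd a b)))
pattern EVAL p xs y      = nd (tg 8) (nd p (nd xs (lf y)))
pattern EVALS ps xs ys   = nd (tg 9) (nd ps (nd xs ys))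
pattern POSITIVE p xs y  = nd (tg 10) (nd p (nd xs (lf y)))
pattern THM a            = nd (tg 11) a
pattern PROVABLE n       = nd (tg 12) (lf n)
pattern REFUTABLE n      = nd (tg 13) (lf n)

termTree : Term → Ground
termTree (var n) = VAR n
termTree 𝟎       = ZERO
termTree (S t)   = SUC (termTree t)
termTree (t ⊕ u) = PLUS (termTree t) (termTree u)
termTree (t ⊗ u) = TIMES (termTree t) (termTree u)

formTree : Formula → Ground
formTree ⊥'      = FALSUM
formTree (t ≐ u) = EQ (termTree t) (termTree u)
formTree (φ ⇒ ψ) = IMP (formTree φ) (formTree ψ)
formTree (∀' φ)  = ALL (formTree φ)

finTree : ∀ {n} → Fin n → Ground
finTree zero    = FZERO
finTree (suc i) = FSUC (finTree i)

progTree : ∀ {n} → PR n → Ground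
progsTree : ∀ {m n} → Vec (PR n) m → Ground
progTree Z           = PZERO
progTree σ           = PSUC
progTree (π i)       = PROJ (finTree i)
progTree (comp f gs) = COMP (progTree f) (progsTree gs)
progTree (prec g h)  = PREC (progTree g) (progTree h)
progTree (μ f)       = MU (progTree f)
progsTree []         = NIL
progsTree (g ∷ gs)   = CONS (progTree g) (progsTree gs)

vecTree : ∀ {n} → Vec ℕ n → Ground
vecTree []       = NIL
vecTree (x ∷ xs) = CONS (lf x) (vecTree xs)

-- Ill-formed trees are read as 𝟎, and by `toFormula` as ⊥'. Being total, the two functions give
-- every rule instance a meaning, so no judgement of well-formedness is needed.
toTerm : Ground → Term
toTerm (VAR n)     = var n
toTerm (SUC t)     = S (toTerm t)
toTerm (PLUS t u)  = toTerm t ⊕ toTerm u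
toTerm (TIMES t u) = toTerm t ⊗ toTerm u
toTerm _           = 𝟎

toFormula : Ground → Formula
toFormula (EQ t u)  = toTerm t ≐ toTerm u
toFormula (IMP a b) = toFormula a ⇒ toFormula b
toFormula (ALL a)   = ∀' (toFormula a)
toFormula _         = ⊥'

-- Evaluation of untyped programs, so that the rules need not check arities. The side condition of
-- μ, universal over smaller arguments, is no Horn premise; `Positive` accumulates it one argument
-- at a time.
data Evaluates : Ground → Ground → ℕ → Set
data EvaluatesAll : Ground → Ground → Ground → Set
data Positive : Ground → Ground → ℕ → Set

data Evaluates where
  Z        : ∀ {s} → Evaluates PZERO s 0
  σ        : ∀ {i} → Evaluates PSUC (CONS (lf i) NIL) (suc i)
  π-zero   : ∀ {i s} → Evaluates (PROJ FZERO) (CONS (lf i) s) i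
  π-suc    : ∀ {a j s l} → Evaluates (PROJ a) s l → Evaluates (PROJ (FSUC a)) (CONS (lf j) s) l
  comp     : ∀ {p q s t l} → EvaluatesAll q s t → Evaluates p t l → Evaluates (COMP p q) s l
  rec-zero : ∀ {p q s l} → Evaluates p s l → Evaluates (PREC p q) (CONS (lf 0) s) l
  rec-suc  : ∀ {p q s l m n} → Evaluates (PREC p q) (CONS (lf l) s) n → Evaluates q (CONS (lf l) (CONS (lf n) s)) m →
             Evaluates (PREC p q) (CONS (lf (suc l)) s) m
  μ        : ∀ {p s k} → Evaluates p (CONS (lf k) s) 0 → Positive p s k → Evaluates (MU p) s k

data EvaluatesAll where
  []  : ∀ {s} → EvaluatesAll NIL s NIL
  _∷_ : ∀ {p q s l t} → Evaluates p s l → EvaluatesAll q s t → EvaluatesAll (CONS p q) s (CONS (lf l) t)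

data Positive where
  zero : ∀ {p s} → Positive p s 0
  suc  : ∀ {p s k l} → Positive p s k → Evaluates p (CONS (lf k) s) (suc l) → Positive p s (suc k)

evaluates-π : ∀ {n} (i : Fin n) (xs : Vec ℕ n) {y} → Evaluates (PROJ (finTree i)) (vecTree xs) y → y ≡ lookup xs i
evaluates-π zero    (x ∷ xs) π-zero    = refl
evaluates-π (suc i) (x ∷ xs) (π-suc e) = evaluates-π i xs e

-- The typed program and its argument vector determine which untyped rules can apply, so arities are
-- recovered while reading the derivation back.
evaluates⇒Eval : ∀ {n} (f : PR n) xs {y} → Evaluates (progTree f) (vecTree xs) y → Eval f xs y
evaluates⇒EvalV : ∀ {m n} (gs : Vec (PR n) m) xs {t} → EvaluatesAll (progsTree gs) (vecTree xs) t →
  ∃ λ ys → t ≡ vecTree ys × EvalV gs xs ys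
positive⇒Eval : ∀ {n} (f : PR (suc n)) xs {y} → Positive (progTree f) (vecTree xs) y →
  ∀ z → z < y → Σ ℕ λ v → Eval f (z ∷ xs) (suc v)

evaluates⇒Eval Z xs Z = ev-Z
evaluates⇒Eval σ (x ∷ []) σ = ev-σ
evaluates⇒Eval (π i) xs e with refl ← evaluates-π i xs e = ev-π
evaluates⇒Eval (comp f gs) xs (comp es e) with evaluates⇒EvalV gs xs es
... | ys , refl , es′ = ev-comp es′ (evaluates⇒Eval f ys e)
evaluates⇒Eval (prec g h) (zero ∷ xs)  (rec-zero e)   = ev-rec0 (evaluates⇒Eval g xs e)
evaluates⇒Eval (prec g h) (suc k ∷ xs) (rec-suc {n = r} e e′) =
  ev-recS (evaluates⇒Eval (prec g h) (k ∷ xs) e) (evaluates⇒Eval h (k ∷ r ∷ xs) e′)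
evaluates⇒Eval (μ f) xs {y} (μ e p) = ev-μ (evaluates⇒Eval f (y ∷ xs) e) (positive⇒Eval f xs p)

evaluates⇒EvalV []       xs []       = [] , refl , []
evaluates⇒EvalV (g ∷ gs) xs (e ∷ es) with evaluates⇒EvalV gs xs es
... | ys , refl , es′ = _ , refl , evaluates⇒Eval g xs e ∷ es′

positive⇒Eval f xs (suc {k = k} p e) z z<1+k with m≤n⇒m<n∨m≡n z<1+k
... | inj₁ (s≤s z<k) = positive⇒Eval f xs p z z<k
... | inj₂ refl      = _ , evaluates⇒Eval f (k ∷ xs) e

-- Injectivity of the Gödel coding

tagT bodyT : Term → ℕ
tagT (var n) = 0
tagT 𝟎       = 1
tagT (S t)   = 2
tagT (t ⊕ u) = 3
tagT (t ⊗ u) = 4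
bodyT (var n) = n
bodyT 𝟎       = 0
bodyT (S t)   = ⌜ t ⌝T
bodyT (t ⊕ u) = pair ⌜ t ⌝T ⌜ u ⌝T
bodyT (t ⊗ u) = pair ⌜ t ⌝T ⌜ u ⌝T

⌜⌝T-pair : ∀ t → ⌜ t ⌝T ≡ pair (tagT t) (bodyT t)
⌜⌝T-pair (var n) = refl
⌜⌝T-pair 𝟎       = refl
⌜⌝T-pair (S t)   = refl
⌜⌝T-pair (t ⊕ u) = refl
⌜⌝T-pair (t ⊗ u) = refl

-- Once every code is exhibited as a single pair of tag and body, comparing tags rules out all cases
-- with different constructors.
⌜⌝T-injective : ∀ t u → ⌜ t ⌝T ≡ ⌜ u ⌝T → t ≡ u
tag-body-injectiveT : ∀ t u → tagT t ≡ tagT u → bodyT t ≡ bodyT u → t ≡ u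
⌜⌝T-injective₂ : ∀ t u v w → pair ⌜ t ⌝T ⌜ u ⌝T ≡ pair ⌜ v ⌝T ⌜ w ⌝T → t ≡ v × u ≡ w

⌜⌝T-injective t u eq = uncurry (tag-body-injectiveT t u)
  (pair-injective (tagT t) (bodyT t) (tagT u) (bodyT u) (trans (sym (⌜⌝T-pair t)) (trans eq (⌜⌝T-pair u))))

tag-body-injectiveT (var m) (var n) refl eq = cong var eq
tag-body-injectiveT 𝟎       𝟎       refl eq = refl
tag-body-injectiveT (S t)   (S u)   refl eq = cong S (⌜⌝T-injective t u eq)
tag-body-injectiveT (t ⊕ u) (v ⊕ w) refl eq = uncurry (cong₂ _⊕_) (⌜⌝T-injective₂ t u v w eq)
tag-body-injectiveT (t ⊗ u) (v ⊗ w) refl eq = uncurry (cong₂ _⊗_) (⌜⌝T-injective₂ t u v w eq)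

⌜⌝T-injective₂ t u v w eq with pair-injective ⌜ t ⌝T ⌜ u ⌝T ⌜ v ⌝T ⌜ w ⌝T eq
... | p , q = ⌜⌝T-injective t v p , ⌜⌝T-injective u w q

tagF bodyF : Formula → ℕ
tagF ⊥'      = 0
tagF (t ≐ u) = 1
tagF (φ ⇒ ψ) = 2
tagF (∀' φ)  = 3
bodyF ⊥'      = 0
bodyF (t ≐ u) = pair ⌜ t ⌝T ⌜ u ⌝T
bodyF (φ ⇒ ψ) = pair ⌜ φ ⌝ ⌜ ψ ⌝
bodyF (∀' φ)  = ⌜ φ ⌝

⌜⌝-pair : ∀ φ → ⌜ φ ⌝ ≡ pair (tagF φ) (bodyF φ)
⌜⌝-pair ⊥'      = refl
⌜⌝-pair (t ≐ u) = refl
⌜⌝-pair (φ ⇒ ψ) = refl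
⌜⌝-pair (∀' φ)  = refl

⌜⌝-injective : ∀ φ ψ → ⌜ φ ⌝ ≡ ⌜ ψ ⌝ → φ ≡ ψ
tag-body-injectiveF : ∀ φ ψ → tagF φ ≡ tagF ψ → bodyF φ ≡ bodyF ψ → φ ≡ ψ

⌜⌝-injective φ ψ eq = uncurry (tag-body-injectiveF φ ψ)
  (pair-injective (tagF φ) (bodyF φ) (tagF ψ) (bodyF ψ) (trans (sym (⌜⌝-pair φ)) (trans eq (⌜⌝-pair ψ))))

tag-body-injectiveF ⊥'      ⊥'      refl eq = refl
tag-body-injectiveF (t ≐ u) (v ≐ w) refl eq = uncurry (cong₂ _≐_) (⌜⌝T-injective₂ t u v w eq)
tag-body-injectiveF (∀' φ)  (∀' ψ)  refl eq = cong ∀' (⌜⌝-injective φ ψ eq)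
tag-body-injectiveF (φ ⇒ ψ) (χ ⇒ ω) refl eq with pair-injective ⌜ φ ⌝ ⌜ ψ ⌝ ⌜ χ ⌝ ⌜ ω ⌝ eq
... | p , q = cong₂ _⇒_ (⌜⌝-injective φ χ p) (⌜⌝-injective ψ ω q)

<ᵇ-less : ∀ m k → (m <ᵇ suc (m + k)) ≡ true
<ᵇ-less zero    k = refl
<ᵇ-less (suc m) k = <ᵇ-less m k

<ᵇ-irrefl : ∀ m → (m <ᵇ m) ≡ false
<ᵇ-irrefl zero    = refl
<ᵇ-irrefl (suc m) = <ᵇ-irrefl m

≡ᵇ-refl : ∀ m → (m ≡ᵇ m) ≡ true
≡ᵇ-refl zero    = refl
≡ᵇ-refl (suc m) = ≡ᵇ-refl m

<ᵇ-greater : ∀ m k → (suc (m + k) <ᵇ m) ≡ false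
<ᵇ-greater zero    k = refl
<ᵇ-greater (suc m) k = <ᵇ-greater m k

≡ᵇ-greater : ∀ m k → (suc (m + k) ≡ᵇ m) ≡ false
≡ᵇ-greater zero    k = refl
≡ᵇ-greater (suc m) k = ≡ᵇ-greater m k

data Rule : Set where
  tri-zero tri-suc pairing code-var code-𝟎 code-S code-⊕ code-⊗ code-⊥ code-≐ code-⇒ code-∀ shift-< shift-≡
    shift-> shift-𝟎 shift-S shift-⊕ shift-⊗ shift-⊥ shift-≐ shift-⇒ shift-∀ subst-< subst-≡ subst-> subst-𝟎
    subst-S subst-⊕ subst-⊗ subst-⊥ subst-≐ subst-⇒ subst-∀ eval-Z eval-σ eval-π-zero eval-π-suc eval-comp
    eval-rec-zero eval-rec-suc eval-μ positive-zero positive-suc evals-[] evals-∷ thm-ax thm-K thm-S thm-DN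
    thm-∀E thm-∀⇒ thm-∀V thm-refl thm-leib thm-mp thm-gen provable refutable : Rule

module Rules (axioms : PR 1) where

  private
    -- The letters i to n and a to g name the same six variables, read as numbers and as trees
    -- respectively; each clause keeps every position to one reading.
    i j k l m n : Tm 6
    i = ` # 0
    j = ` # 1
    k = ` # 2
    l = ` # 3
    m = ` # 4
    n = ` # 5

    a b c d e g : Pattern 6
    a = tv (# 0)
    b = tv (# 1)
    c = tv (# 2)
    d = tv (# 3)
    e = tv (# 4)
    g = tv (# 5)

  clause : Rule → Clause 6
  clause tri-zero = TRI `0 `0 ⊣ []
  clause tri-suc = TRI (`suc i) (j `+ `suc i) ⊣ TRI i j ∷ []
  clause pairing = PAIR i j (k `+ j) ⊣ TRI (i `+ j) k ∷ []
  clause code-var = CODET i (VAR j) ⊣ PAIR `0 j i ∷ []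
  clause code-𝟎 = CODET i ZERO ⊣ PAIR (`num 1) `0 i ∷ []
  clause code-S = CODET i (SUC b) ⊣ CODET k b ∷ PAIR (`num 2) k i ∷ []
  clause code-⊕ = CODET i (PLUS b c) ⊣ CODET l b ∷ CODET m c ∷ PAIR l m n ∷ PAIR (`num 3) n i ∷ []
  clause code-⊗ = CODET i (TIMES b c) ⊣ CODET l b ∷ CODET m c ∷ PAIR l m n ∷ PAIR (`num 4) n i ∷ []
  clause code-⊥ = CODEF i FALSUM ⊣ PAIR `0 `0 i ∷ []
  clause code-≐ = CODEF i (EQ b c) ⊣ CODET l b ∷ CODET m c ∷ PAIR l m n ∷ PAIR (`num 1) n i ∷ []
  clause code-⇒ = CODEF i (IMP b c) ⊣ CODEF l b ∷ CODEF m c ∷ PAIR l m n ∷ PAIR (`num 2) n i ∷ []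
  clause code-∀ = CODEF i (ALL b) ⊣ CODEF k b ∷ PAIR (`num 3) k i ∷ []
  -- Horn rules cannot test an inequality, so the position of an index relative to the cutoff is
  -- expressed by a sum, with the same three shapes as in `compare`.
  clause shift-< = SHIFTT (`suc (j `+ i)) (VAR j) (VAR j) ⊣ []
  clause shift-≡ = SHIFTT i (VAR i) (VAR (`suc i)) ⊣ []
  clause shift-> = SHIFTT i (VAR (`suc (i `+ j))) (VAR (`suc (`suc (i `+ j)))) ⊣ []
  clause shift-𝟎 = SHIFTT i ZERO ZERO ⊣ []
  clause shift-S = SHIFTT i (SUC b) (SUC c) ⊣ SHIFTT i b c ∷ []
  clause shift-⊕ = SHIFTT i (PLUS b c) (PLUS d e) ⊣ SHIFTT i b d ∷ SHIFTT i c e ∷ []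
  clause shift-⊗ = SHIFTT i (TIMES b c) (TIMES d e) ⊣ SHIFTT i b d ∷ SHIFTT i c e ∷ []
  clause shift-⊥ = SHIFTF i FALSUM FALSUM ⊣ []
  clause shift-≐ = SHIFTF i (EQ b c) (EQ d e) ⊣ SHIFTT i b d ∷ SHIFTT i c e ∷ []
  clause shift-⇒ = SHIFTF i (IMP b c) (IMP d e) ⊣ SHIFTF i b d ∷ SHIFTF i c e ∷ []
  clause shift-∀ = SHIFTF i (ALL b) (ALL c) ⊣ SHIFTF (`suc i) b c ∷ []
  clause subst-< = SUBSTT (`suc (j `+ i)) c (VAR j) (VAR j) ⊣ []
  clause subst-≡ = SUBSTT i b (VAR i) b ⊣ []
  clause subst-> = SUBSTT i c (VAR (`suc (i `+ j))) (VAR (i `+ j)) ⊣ []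
  clause subst-𝟎 = SUBSTT i b ZERO ZERO ⊣ []
  clause subst-S = SUBSTT i b (SUC c) (SUC d) ⊣ SUBSTT i b c d ∷ []
  clause subst-⊕ = SUBSTT i b (PLUS c d) (PLUS e g) ⊣ SUBSTT i b c e ∷ SUBSTT i b d g ∷ []
  clause subst-⊗ = SUBSTT i b (TIMES c d) (TIMES e g) ⊣ SUBSTT i b c e ∷ SUBSTT i b d g ∷ []
  clause subst-⊥ = SUBSTF i b FALSUM FALSUM ⊣ []
  clause subst-≐ = SUBSTF i b (EQ c d) (EQ e g) ⊣ SUBSTT i b c e ∷ SUBSTT i b d g ∷ []
  clause subst-⇒ = SUBSTF i b (IMP c d) (IMP e g) ⊣ SUBSTF i b c e ∷ SUBSTF i b d g ∷ []
  clause subst-∀ = SUBSTF i b (ALL c) (ALL d) ⊣ SHIFTT `0 b e ∷ SUBSTF (`suc i) e c d ∷ []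
  clause eval-Z = EVAL PZERO a `0 ⊣ []
  clause eval-σ = EVAL PSUC (CONS (lf i) NIL) (`suc i) ⊣ []
  clause eval-π-zero = EVAL (PROJ FZERO) (CONS (lf i) b) i ⊣ []
  clause eval-π-suc = EVAL (PROJ (FSUC a)) (CONS (lf j) c) l ⊣ EVAL (PROJ a) c l ∷ []
  clause eval-comp = EVAL (COMP a b) c l ⊣ EVALS b c e ∷ EVAL a e l ∷ []
  clause eval-rec-zero = EVAL (PREC a b) (CONS (lf `0) c) l ⊣ EVAL a c l ∷ []
  clause eval-rec-suc = EVAL (PREC a b) (CONS (lf (`suc l)) c) m ⊣ EVAL (PREC a b) (CONS (lf l) c) n ∷ EVAL b (CONS (lf l) (CONS (lf n) c)) m ∷ []
  clause eval-μ = EVAL (MU a) b k ⊣ EVAL a (CONS (lf k) b) `0 ∷ POSITIVE a b k ∷ []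
  clause positive-zero = POSITIVE a b `0 ⊣ []
  clause positive-suc = POSITIVE a b (`suc k) ⊣ POSITIVE a b k ∷ EVAL a (CONS (lf k) b) (`suc l) ∷ []
  clause evals-[] = EVALS NIL a NIL ⊣ []
  clause evals-∷ = EVALS (CONS a b) c (CONS (lf l) e) ⊣ EVAL a c l ∷ EVALS b c e ∷ []
  -- A formula is an axiom when the enumerating program halts on its code, whatever the value `k`.
  clause thm-ax = THM a ⊣ CODEF j a ∷ EVAL (embed (progTree axioms)) (CONS (lf j) NIL) k ∷ []
  clause thm-K = THM (IMP a (IMP b a)) ⊣ []
  clause thm-S = THM (IMP (IMP a (IMP b c)) (IMP (IMP a b) (IMP a c))) ⊣ []
  clause thm-DN = THM (IMP (NOT (NOT a)) a) ⊣ []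
  clause thm-∀E = THM (IMP (ALL a) c) ⊣ SUBSTF `0 b a c ∷ []
  clause thm-∀⇒ = THM (IMP (ALL (IMP a b)) (IMP (ALL a) (ALL b))) ⊣ []
  clause thm-∀V = THM (IMP a (ALL b)) ⊣ SHIFTF `0 a b ∷ []
  clause thm-refl = THM (EQ a a) ⊣ []
  clause thm-leib = THM (IMP (EQ a b) (IMP d e)) ⊣ SUBSTF `0 a c d ∷ SUBSTF `0 b c e ∷ []
  clause thm-mp = THM b ⊣ THM (IMP a b) ∷ THM a ∷ []
  clause thm-gen = THM (ALL a) ⊣ THM a ∷ []
  clause provable = PROVABLE i ⊣ CODEF i b ∷ THM b ∷ []
  clause refutable = REFUTABLE i ⊣ CODEF i b ∷ THM (NOT b) ∷ []

  rules : List Rule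
  rules =
    tri-zero ∷ tri-suc ∷ pairing ∷ code-var ∷ code-𝟎 ∷ code-S ∷ code-⊕ ∷ code-⊗ ∷ code-⊥ ∷ code-≐ ∷ code-⇒ ∷
    code-∀ ∷ shift-< ∷ shift-≡ ∷ shift-> ∷ shift-𝟎 ∷ shift-S ∷ shift-⊕ ∷ shift-⊗ ∷ shift-⊥ ∷ shift-≐ ∷
    shift-⇒ ∷ shift-∀ ∷ subst-< ∷ subst-≡ ∷ subst-> ∷ subst-𝟎 ∷ subst-S ∷ subst-⊕ ∷ subst-⊗ ∷ subst-⊥ ∷
    subst-≐ ∷ subst-⇒ ∷ subst-∀ ∷ eval-Z ∷ eval-σ ∷ eval-π-zero ∷ eval-π-suc ∷ eval-comp ∷ eval-rec-zero ∷
    eval-rec-suc ∷ eval-μ ∷ positive-zero ∷ positive-suc ∷ evals-[] ∷ evals-∷ ∷ thm-ax ∷ thm-K ∷ thm-S ∷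
    thm-DN ∷ thm-∀E ∷ thm-∀⇒ ∷ thm-∀V ∷ thm-refl ∷ thm-leib ∷ thm-mp ∷ thm-gen ∷ provable ∷ refutable ∷ []

  ∈rules : ∀ s → s ∈ rules
  ∈rules tri-zero = ∈-lookup (# 0)
  ∈rules tri-suc = ∈-lookup (# 1)
  ∈rules pairing = ∈-lookup (# 2)
  ∈rules code-var = ∈-lookup (# 3)
  ∈rules code-𝟎 = ∈-lookup (# 4)
  ∈rules code-S = ∈-lookup (# 5)
  ∈rules code-⊕ = ∈-lookup (# 6)
  ∈rules code-⊗ = ∈-lookup (# 7)
  ∈rules code-⊥ = ∈-lookup (# 8)
  ∈rules code-≐ = ∈-lookup (# 9)
  ∈rules code-⇒ = ∈-lookup (# 10)
  ∈rules code-∀ = ∈-lookup (# 11)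
  ∈rules shift-< = ∈-lookup (# 12)
  ∈rules shift-≡ = ∈-lookup (# 13)
  ∈rules shift-> = ∈-lookup (# 14)
  ∈rules shift-𝟎 = ∈-lookup (# 15)
  ∈rules shift-S = ∈-lookup (# 16)
  ∈rules shift-⊕ = ∈-lookup (# 17)
  ∈rules shift-⊗ = ∈-lookup (# 18)
  ∈rules shift-⊥ = ∈-lookup (# 19)
  ∈rules shift-≐ = ∈-lookup (# 20)
  ∈rules shift-⇒ = ∈-lookup (# 21)
  ∈rules shift-∀ = ∈-lookup (# 22)
  ∈rules subst-< = ∈-lookup (# 23)
  ∈rules subst-≡ = ∈-lookup (# 24)
  ∈rules subst-> = ∈-lookup (# 25)
  ∈rules subst-𝟎 = ∈-lookup (# 26)
  ∈rules subst-S = ∈-lookup (# 27)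
  ∈rules subst-⊕ = ∈-lookup (# 28)
  ∈rules subst-⊗ = ∈-lookup (# 29)
  ∈rules subst-⊥ = ∈-lookup (# 30)
  ∈rules subst-≐ = ∈-lookup (# 31)
  ∈rules subst-⇒ = ∈-lookup (# 32)
  ∈rules subst-∀ = ∈-lookup (# 33)
  ∈rules eval-Z = ∈-lookup (# 34)
  ∈rules eval-σ = ∈-lookup (# 35)
  ∈rules eval-π-zero = ∈-lookup (# 36)
  ∈rules eval-π-suc = ∈-lookup (# 37)
  ∈rules eval-comp = ∈-lookup (# 38)
  ∈rules eval-rec-zero = ∈-lookup (# 39)
  ∈rules eval-rec-suc = ∈-lookup (# 40)
  ∈rules eval-μ = ∈-lookup (# 41)
  ∈rules positive-zero = ∈-lookup (# 42)
  ∈rules positive-suc = ∈-lookup (# 43)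
  ∈rules evals-[] = ∈-lookup (# 44)
  ∈rules evals-∷ = ∈-lookup (# 45)
  ∈rules thm-ax = ∈-lookup (# 46)
  ∈rules thm-K = ∈-lookup (# 47)
  ∈rules thm-S = ∈-lookup (# 48)
  ∈rules thm-DN = ∈-lookup (# 49)
  ∈rules thm-∀E = ∈-lookup (# 50)
  ∈rules thm-∀⇒ = ∈-lookup (# 51)
  ∈rules thm-∀V = ∈-lookup (# 52)
  ∈rules thm-refl = ∈-lookup (# 53)
  ∈rules thm-leib = ∈-lookup (# 54)
  ∈rules thm-mp = ∈-lookup (# 55)
  ∈rules thm-gen = ∈-lookup (# 56)
  ∈rules provable = ∈-lookup (# 57)
  ∈rules refutable = ∈-lookup (# 58)

  open Horn clause rules ∈rules public

-- Derivable judgements are true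

module Soundness (T : Theory) (re : RETheory T) where

  open Rules (proj₁ re)

  -- Everything syntactic is stated through the formulas that trees decode to. Trees and formulas
  -- meet again only at Gödel numbers, so it need not be shown that `toFormula` inverts `formTree`.
  Meaning : Ground → Set
  Meaning (TRI i n)        = n ≡ half i
  Meaning (PAIR i j n)     = n ≡ pair i j
  Meaning (CODET n t)      = n ≡ ⌜ toTerm t ⌝T
  Meaning (CODEF n a)      = n ≡ ⌜ toFormula a ⌝
  Meaning (SHIFTT i t u)   = toTerm u ≡ shiftT i (toTerm t)
  Meaning (SHIFTF i a b)   = toFormula b ≡ shift i (toFormula a)
  Meaning (SUBSTT i s t u) = toTerm u ≡ substT i (toTerm s) (toTerm t)
  Meaning (SUBSTF i s a b) = toFormula b ≡ subst i (toTerm s) (toFormula a)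
  Meaning (EVAL p xs y)    = Evaluates p xs y
  Meaning (EVALS p xs ys)  = EvaluatesAll p xs ys
  Meaning (POSITIVE p s y) = Positive p s y
  Meaning (THM a)          = T ⊢ toFormula a
  Meaning (PROVABLE n)     = ∃ λ φ → n ≡ ⌜ φ ⌝ × T ⊢ φ
  Meaning (REFUTABLE n)    = ∃ λ φ → n ≡ ⌜ φ ⌝ × T ⊢ ¬' φ
  Meaning _                = ⊤

  -- Halting yields some axiom with the same code, and injectivity of the coding identifies it with
  -- φ.
  axiom-sound : ∀ {φ v} → Evaluates (progTree (proj₁ re)) (vecTree (⌜ φ ⌝ ∷ [])) v → T ⊢ φ
  axiom-sound {φ} e with proj₂ (proj₂ re ⌜ φ ⌝) (_ , evaluates⇒Eval (proj₁ re) _ e)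
  ... | ψ , Tψ , eq = ≡.subst (T ⊢_) (⌜⌝-injective ψ φ eq) (ax Tψ)

  Meaning-closed : ∀ s ρ → All (λ P → Meaning (treeAt ρ P)) (Clause.body (clause s)) → Meaning (treeAt ρ (Clause.head (clause s)))
  Meaning-closed tri-zero _ [] = refl
  Meaning-closed tri-suc (i ∷ _) (h ∷ []) = trans (cong (_+ suc i) h) (sym (half-suc i))
  Meaning-closed pairing (i ∷ j ∷ _) (h ∷ []) = cong (_+ j) h
  Meaning-closed code-var _ (h ∷ []) = h
  Meaning-closed code-𝟎 _ (h ∷ []) = h
  Meaning-closed code-S _ (h ∷ h′ ∷ []) = trans h′ (cong (pair 2) h)
  Meaning-closed code-⊕ _ (h₁ ∷ h₂ ∷ h₃ ∷ h₄ ∷ []) = trans h₄ (cong (pair 3) (trans h₃ (cong₂ pair h₁ h₂)))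
  Meaning-closed code-⊗ _ (h₁ ∷ h₂ ∷ h₃ ∷ h₄ ∷ []) = trans h₄ (cong (pair 4) (trans h₃ (cong₂ pair h₁ h₂)))
  Meaning-closed code-⊥ _ (h ∷ []) = h
  Meaning-closed code-≐ _ (h₁ ∷ h₂ ∷ h₃ ∷ h₄ ∷ []) = trans h₄ (cong (pair 1) (trans h₃ (cong₂ pair h₁ h₂)))
  Meaning-closed code-⇒ _ (h₁ ∷ h₂ ∷ h₃ ∷ h₄ ∷ []) = trans h₄ (cong (pair 2) (trans h₃ (cong₂ pair h₁ h₂)))
  Meaning-closed code-∀ _ (h ∷ h′ ∷ []) = trans h′ (cong (pair 3) h)
  Meaning-closed shift-< (i ∷ j ∷ _) [] rewrite <ᵇ-less j i = refl
  Meaning-closed shift-≡ (i ∷ _) [] rewrite <ᵇ-irrefl i = refl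
  Meaning-closed shift-> (i ∷ j ∷ _) [] rewrite <ᵇ-greater i j = refl
  Meaning-closed shift-𝟎 _ [] = refl
  Meaning-closed shift-S _ (h ∷ []) = cong S h
  Meaning-closed shift-⊕ _ (h ∷ h′ ∷ []) = cong₂ _⊕_ h h′
  Meaning-closed shift-⊗ _ (h ∷ h′ ∷ []) = cong₂ _⊗_ h h′
  Meaning-closed shift-⊥ _ [] = refl
  Meaning-closed shift-≐ _ (h ∷ h′ ∷ []) = cong₂ _≐_ h h′
  Meaning-closed shift-⇒ _ (h ∷ h′ ∷ []) = cong₂ _⇒_ h h′
  Meaning-closed shift-∀ _ (h ∷ []) = cong ∀' h
  Meaning-closed subst-< (i ∷ j ∷ _) [] rewrite <ᵇ-less j i = refl
  Meaning-closed subst-≡ (i ∷ _) [] rewrite <ᵇ-irrefl i | ≡ᵇ-refl i = refl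
  Meaning-closed subst-> (i ∷ j ∷ _) [] rewrite <ᵇ-greater i j | ≡ᵇ-greater i j = refl
  Meaning-closed subst-𝟎 _ [] = refl
  Meaning-closed subst-S _ (h ∷ []) = cong S h
  Meaning-closed subst-⊕ _ (h ∷ h′ ∷ []) = cong₂ _⊕_ h h′
  Meaning-closed subst-⊗ _ (h ∷ h′ ∷ []) = cong₂ _⊗_ h h′
  Meaning-closed subst-⊥ _ [] = refl
  Meaning-closed subst-≐ _ (h ∷ h′ ∷ []) = cong₂ _≐_ h h′
  Meaning-closed subst-⇒ _ (h ∷ h′ ∷ []) = cong₂ _⇒_ h h′
  Meaning-closed subst-∀ (i ∷ _ ∷ c ∷ _) (h ∷ h′ ∷ []) = cong ∀' (trans h′ (cong (λ s → subst (suc i) s (toFormula (decode c))) h))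
  Meaning-closed eval-Z _ [] = Z
  Meaning-closed eval-σ _ [] = σ
  Meaning-closed eval-π-zero _ [] = π-zero
  Meaning-closed eval-π-suc _ (h ∷ []) = π-suc h
  Meaning-closed eval-comp _ (h ∷ h′ ∷ []) = comp h h′
  Meaning-closed eval-rec-zero _ (h ∷ []) = rec-zero h
  Meaning-closed eval-rec-suc _ (h ∷ h′ ∷ []) = rec-suc h h′
  Meaning-closed eval-μ _ (h ∷ h′ ∷ []) = μ h h′
  Meaning-closed positive-zero _ [] = zero
  Meaning-closed positive-suc _ (h ∷ h′ ∷ []) = suc h h′
  Meaning-closed evals-[] _ [] = []
  Meaning-closed evals-∷ _ (h ∷ h′ ∷ []) = h ∷ h′
  Meaning-closed thm-ax ρ@(a ∷ _ ∷ k ∷ _) (h ∷ h′ ∷ []) = axiom-sound {toFormula (decode a)} {k}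
    (≡.subst₂ (λ p x → Evaluates p (CONS (lf x) NIL) k) (treeAt-embed ρ (progTree (proj₁ re))) h h′)
  Meaning-closed thm-K _ [] = ax-K
  Meaning-closed thm-S _ [] = ax-S
  Meaning-closed thm-DN _ [] = ax-DN
  Meaning-closed thm-∀E (a ∷ b ∷ _) (h ∷ []) = ≡.subst (λ ψ → T ⊢ ∀' (toFormula (decode a)) ⇒ ψ) (sym h) (ax-∀E (toTerm (decode b)))
  Meaning-closed thm-∀⇒ _ [] = ax-∀⇒
  Meaning-closed thm-∀V (a ∷ _) (h ∷ []) = ≡.subst (λ ψ → T ⊢ toFormula (decode a) ⇒ ∀' ψ) (sym h) ax-∀V
  Meaning-closed thm-refl (a ∷ _) [] = ax-refl (toTerm (decode a))
  Meaning-closed thm-leib (a ∷ b ∷ c ∷ _) (h ∷ h′ ∷ []) =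
    ≡.subst₂ (λ φ ψ → T ⊢ toTerm (decode a) ≐ toTerm (decode b) ⇒ φ ⇒ ψ) (sym h) (sym h′)
      (ax-leib {φ = toFormula (decode c)} (toTerm (decode a)) (toTerm (decode b)))
  Meaning-closed thm-mp _ (h ∷ h′ ∷ []) = mp h h′
  Meaning-closed thm-gen _ (h ∷ []) = gen h
  Meaning-closed provable _ (h ∷ h′ ∷ []) = _ , h , h′
  Meaning-closed refutable _ (h ∷ h′ ∷ []) = _ , h , h′

-- True judgements are derivable

module Completeness (T : Theory) (re : RETheory T) where

  open Rules (proj₁ re)

  ⊢ᵈ_ : Ground → Set
  ⊢ᵈ t = Derivable (code t)

  -- Each rule is given the values of its six variables, with 0 in the positions absent from its
  -- clause.
  half-derivable : ∀ s → ⊢ᵈ TRI s (half s)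
  half-derivable zero    = by-rule tri-zero (0 ∷ 0 ∷ 0 ∷ 0 ∷ 0 ∷ 0 ∷ []) []
  half-derivable (suc s) = ≡.subst (λ h → ⊢ᵈ TRI (suc s) h) (sym (half-suc s))
    (by-rule tri-suc (s ∷ half s ∷ 0 ∷ 0 ∷ 0 ∷ 0 ∷ []) (half-derivable s ∷ []))

  pair-derivable : ∀ x y → ⊢ᵈ PAIR x y (pair x y)
  pair-derivable x y = by-rule pairing (x ∷ y ∷ half (x + y) ∷ 0 ∷ 0 ∷ 0 ∷ []) (half-derivable (x + y) ∷ [])

  codeT-derivable : ∀ t → ⊢ᵈ CODET ⌜ t ⌝T (termTree t)
  codeT-derivable (var x) = by-rule code-var (⌜ var x ⌝T ∷ x ∷ 0 ∷ 0 ∷ 0 ∷ 0 ∷ []) (pair-derivable 0 x ∷ [])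
  codeT-derivable 𝟎 = by-rule code-𝟎 (⌜ 𝟎 ⌝T ∷ 0 ∷ 0 ∷ 0 ∷ 0 ∷ 0 ∷ []) (pair-derivable 1 0 ∷ [])
  codeT-derivable (S t) = by-rule code-S (⌜ S t ⌝T ∷ code (termTree t) ∷ ⌜ t ⌝T ∷ 0 ∷ 0 ∷ 0 ∷ [])
    (codeT-derivable t ∷ pair-derivable 2 ⌜ t ⌝T ∷ [])
  codeT-derivable (t ⊕ u) = by-rule code-⊕
    (⌜ t ⊕ u ⌝T ∷ code (termTree t) ∷ code (termTree u) ∷ ⌜ t ⌝T ∷ ⌜ u ⌝T ∷ pair ⌜ t ⌝T ⌜ u ⌝T ∷ [])
    (codeT-derivable t ∷ codeT-derivable u ∷ pair-derivable ⌜ t ⌝T ⌜ u ⌝T ∷ pair-derivable 3 (pair ⌜ t ⌝T ⌜ u ⌝T) ∷ [])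
  codeT-derivable (t ⊗ u) = by-rule code-⊗
    (⌜ t ⊗ u ⌝T ∷ code (termTree t) ∷ code (termTree u) ∷ ⌜ t ⌝T ∷ ⌜ u ⌝T ∷ pair ⌜ t ⌝T ⌜ u ⌝T ∷ [])
    (codeT-derivable t ∷ codeT-derivable u ∷ pair-derivable ⌜ t ⌝T ⌜ u ⌝T ∷ pair-derivable 4 (pair ⌜ t ⌝T ⌜ u ⌝T) ∷ [])

  code-derivable : ∀ φ → ⊢ᵈ CODEF ⌜ φ ⌝ (formTree φ)
  code-derivable ⊥' = by-rule code-⊥ (⌜ ⊥' ⌝ ∷ 0 ∷ 0 ∷ 0 ∷ 0 ∷ 0 ∷ []) (pair-derivable 0 0 ∷ [])
  code-derivable (t ≐ u) = by-rule code-≐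
    (⌜ t ≐ u ⌝ ∷ code (termTree t) ∷ code (termTree u) ∷ ⌜ t ⌝T ∷ ⌜ u ⌝T ∷ pair ⌜ t ⌝T ⌜ u ⌝T ∷ [])
    (codeT-derivable t ∷ codeT-derivable u ∷ pair-derivable ⌜ t ⌝T ⌜ u ⌝T ∷ pair-derivable 1 (pair ⌜ t ⌝T ⌜ u ⌝T) ∷ [])
  code-derivable (φ ⇒ ψ) = by-rule code-⇒
    (⌜ φ ⇒ ψ ⌝ ∷ code (formTree φ) ∷ code (formTree ψ) ∷ ⌜ φ ⌝ ∷ ⌜ ψ ⌝ ∷ pair ⌜ φ ⌝ ⌜ ψ ⌝ ∷ [])
    (code-derivable φ ∷ code-derivable ψ ∷ pair-derivable ⌜ φ ⌝ ⌜ ψ ⌝ ∷ pair-derivable 2 (pair ⌜ φ ⌝ ⌜ ψ ⌝) ∷ [])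
  code-derivable (∀' φ) = by-rule code-∀ (⌜ ∀' φ ⌝ ∷ code (formTree φ) ∷ ⌜ φ ⌝ ∷ 0 ∷ 0 ∷ 0 ∷ [])
    (code-derivable φ ∷ pair-derivable 3 ⌜ φ ⌝ ∷ [])

  shiftT-derivable : ∀ x t → ⊢ᵈ SHIFTT x (termTree t) (termTree (shiftT x t))
  shiftT-derivable x (var y) with compare y x
  ... | less y z rewrite <ᵇ-less y z = by-rule shift-< (z ∷ y ∷ 0 ∷ 0 ∷ 0 ∷ 0 ∷ []) []
  ... | equal y rewrite <ᵇ-irrefl y = by-rule shift-≡ (y ∷ 0 ∷ 0 ∷ 0 ∷ 0 ∷ 0 ∷ []) []
  ... | greater x z rewrite <ᵇ-greater x z = by-rule shift-> (x ∷ z ∷ 0 ∷ 0 ∷ 0 ∷ 0 ∷ []) []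
  shiftT-derivable x 𝟎 = by-rule shift-𝟎 (x ∷ 0 ∷ 0 ∷ 0 ∷ 0 ∷ 0 ∷ []) []
  shiftT-derivable x (S t) = by-rule shift-S (x ∷ code (termTree t) ∷ code (termTree (shiftT x t)) ∷ 0 ∷ 0 ∷ 0 ∷ [])
    (shiftT-derivable x t ∷ [])
  shiftT-derivable x (t ⊕ u) = by-rule shift-⊕
    (x ∷ code (termTree t) ∷ code (termTree u) ∷ code (termTree (shiftT x t)) ∷ code (termTree (shiftT x u)) ∷ 0 ∷ [])
    (shiftT-derivable x t ∷ shiftT-derivable x u ∷ [])
  shiftT-derivable x (t ⊗ u) = by-rule shift-⊗
    (x ∷ code (termTree t) ∷ code (termTree u) ∷ code (termTree (shiftT x t)) ∷ code (termTree (shiftT x u)) ∷ 0 ∷ [])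
    (shiftT-derivable x t ∷ shiftT-derivable x u ∷ [])

  shift-derivable : ∀ x φ → ⊢ᵈ SHIFTF x (formTree φ) (formTree (shift x φ))
  shift-derivable x ⊥' = by-rule shift-⊥ (x ∷ 0 ∷ 0 ∷ 0 ∷ 0 ∷ 0 ∷ []) []
  shift-derivable x (t ≐ u) = by-rule shift-≐
    (x ∷ code (termTree t) ∷ code (termTree u) ∷ code (termTree (shiftT x t)) ∷ code (termTree (shiftT x u)) ∷ 0 ∷ [])
    (shiftT-derivable x t ∷ shiftT-derivable x u ∷ [])
  shift-derivable x (φ ⇒ ψ) = by-rule shift-⇒
    (x ∷ code (formTree φ) ∷ code (formTree ψ) ∷ code (formTree (shift x φ)) ∷ code (formTree (shift x ψ)) ∷ 0 ∷ [])
    (shift-derivable x φ ∷ shift-derivable x ψ ∷ [])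
  shift-derivable x (∀' φ) = by-rule shift-∀
    (x ∷ code (formTree φ) ∷ code (formTree (shift (suc x) φ)) ∷ 0 ∷ 0 ∷ 0 ∷ []) (shift-derivable (suc x) φ ∷ [])

  substT-derivable : ∀ x s t → ⊢ᵈ SUBSTT x (termTree s) (termTree t) (termTree (substT x s t))
  substT-derivable x s (var y) with compare y x
  ... | less y z rewrite <ᵇ-less y z = by-rule subst-< (z ∷ y ∷ code (termTree s) ∷ 0 ∷ 0 ∷ 0 ∷ []) []
  ... | equal y rewrite <ᵇ-irrefl y | ≡ᵇ-refl y = by-rule subst-≡ (y ∷ code (termTree s) ∷ 0 ∷ 0 ∷ 0 ∷ 0 ∷ []) []
  ... | greater x z rewrite <ᵇ-greater x z | ≡ᵇ-greater x z = by-rule subst-> (x ∷ z ∷ code (termTree s) ∷ 0 ∷ 0 ∷ 0 ∷ []) []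
  substT-derivable x s 𝟎 = by-rule subst-𝟎 (x ∷ code (termTree s) ∷ 0 ∷ 0 ∷ 0 ∷ 0 ∷ []) []
  substT-derivable x s (S t) = by-rule subst-S
    (x ∷ code (termTree s) ∷ code (termTree t) ∷ code (termTree (substT x s t)) ∷ 0 ∷ 0 ∷ []) (substT-derivable x s t ∷ [])
  substT-derivable x s (t ⊕ u) = by-rule subst-⊕
    (x ∷ code (termTree s) ∷ code (termTree t) ∷ code (termTree u) ∷ code (termTree (substT x s t)) ∷ code (termTree (substT x s u)) ∷ [])
    (substT-derivable x s t ∷ substT-derivable x s u ∷ [])
  substT-derivable x s (t ⊗ u) = by-rule subst-⊗
    (x ∷ code (termTree s) ∷ code (termTree t) ∷ code (termTree u) ∷ code (termTree (substT x s t)) ∷ code (termTree (substT x s u)) ∷ [])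
    (substT-derivable x s t ∷ substT-derivable x s u ∷ [])

  subst-derivable : ∀ x s φ → ⊢ᵈ SUBSTF x (termTree s) (formTree φ) (formTree (subst x s φ))
  subst-derivable x s ⊥' = by-rule subst-⊥ (x ∷ code (termTree s) ∷ 0 ∷ 0 ∷ 0 ∷ 0 ∷ []) []
  subst-derivable x s (t ≐ u) = by-rule subst-≐
    (x ∷ code (termTree s) ∷ code (termTree t) ∷ code (termTree u) ∷ code (termTree (substT x s t)) ∷ code (termTree (substT x s u)) ∷ [])
    (substT-derivable x s t ∷ substT-derivable x s u ∷ [])
  subst-derivable x s (φ ⇒ ψ) = by-rule subst-⇒
    (x ∷ code (termTree s) ∷ code (formTree φ) ∷ code (formTree ψ) ∷ code (formTree (subst x s φ)) ∷ code (formTree (subst x s ψ)) ∷ [])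
    (subst-derivable x s φ ∷ subst-derivable x s ψ ∷ [])
  subst-derivable x s (∀' φ) = by-rule subst-∀
    (x ∷ code (termTree s) ∷ code (formTree φ) ∷ code (formTree (subst (suc x) (shiftT 0 s) φ)) ∷ code (termTree (shiftT 0 s)) ∷ 0 ∷ [])
    (shiftT-derivable 0 s ∷ subst-derivable (suc x) (shiftT 0 s) φ ∷ [])

  lookup-derivable : ∀ {n} (x : Fin n) ys → ⊢ᵈ EVAL (PROJ (finTree x)) (vecTree ys) (lookup ys x)
  lookup-derivable zero    (y ∷ ys) = by-rule eval-π-zero (y ∷ code (vecTree ys) ∷ 0 ∷ 0 ∷ 0 ∷ 0 ∷ []) []
  lookup-derivable (suc x) (y ∷ ys) = by-rule eval-π-suc
    (code (finTree x) ∷ y ∷ code (vecTree ys) ∷ lookup ys x ∷ 0 ∷ 0 ∷ []) (lookup-derivable x ys ∷ [])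

  eval-derivable : ∀ {n} (f : PR n) xs {y} → Eval f xs y → ⊢ᵈ EVAL (progTree f) (vecTree xs) y
  evals-derivable : ∀ {m n} (gs : Vec (PR n) m) xs {ys} → EvalV gs xs ys → ⊢ᵈ EVALS (progsTree gs) (vecTree xs) (vecTree ys)
  positive-derivable : ∀ {n} (f : PR (suc n)) xs y → (∀ z → z < y → Σ ℕ λ v → Eval f (z ∷ xs) (suc v)) →
    ⊢ᵈ POSITIVE (progTree f) (vecTree xs) y

  eval-derivable Z xs ev-Z = by-rule eval-Z (code (vecTree xs) ∷ 0 ∷ 0 ∷ 0 ∷ 0 ∷ 0 ∷ []) []
  eval-derivable σ (x ∷ []) ev-σ = by-rule eval-σ (x ∷ 0 ∷ 0 ∷ 0 ∷ 0 ∷ 0 ∷ []) []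
  eval-derivable (π i) xs ev-π = lookup-derivable i xs
  eval-derivable (comp f gs) xs {y} (ev-comp {ys = ys} es e) = by-rule eval-comp
    (code (progTree f) ∷ code (progsTree gs) ∷ code (vecTree xs) ∷ y ∷ code (vecTree ys) ∷ 0 ∷ [])
    (evals-derivable gs xs es ∷ eval-derivable f ys e ∷ [])
  eval-derivable (prec g h) (zero ∷ xs) {y} (ev-rec0 e) = by-rule eval-rec-zero
    (code (progTree g) ∷ code (progTree h) ∷ code (vecTree xs) ∷ y ∷ 0 ∷ 0 ∷ []) (eval-derivable g xs e ∷ [])
  eval-derivable (prec g h) (suc x ∷ xs) {y} (ev-recS {r = r} e e′) = by-rule eval-rec-suc
    (code (progTree g) ∷ code (progTree h) ∷ code (vecTree xs) ∷ x ∷ y ∷ r ∷ [])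
    (eval-derivable (prec g h) (x ∷ xs) e ∷ eval-derivable h (x ∷ r ∷ xs) e′ ∷ [])
  eval-derivable (μ f) xs {y} (ev-μ e p) = by-rule eval-μ
    (code (progTree f) ∷ code (vecTree xs) ∷ y ∷ 0 ∷ 0 ∷ 0 ∷ [])
    (eval-derivable f (y ∷ xs) e ∷ positive-derivable f xs y p ∷ [])

  evals-derivable [] xs [] = by-rule evals-[] (code (vecTree xs) ∷ 0 ∷ 0 ∷ 0 ∷ 0 ∷ 0 ∷ []) []
  evals-derivable (g ∷ gs) xs {y ∷ ys} (e ∷ es) = by-rule evals-∷
    (code (progTree g) ∷ code (progsTree gs) ∷ code (vecTree xs) ∷ y ∷ code (vecTree ys) ∷ 0 ∷ [])
    (eval-derivable g xs e ∷ evals-derivable gs xs es ∷ [])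

  positive-derivable f xs zero    p = by-rule positive-zero (code (progTree f) ∷ code (vecTree xs) ∷ 0 ∷ 0 ∷ 0 ∷ 0 ∷ []) []
  positive-derivable f xs (suc y) p = by-rule positive-suc
    (code (progTree f) ∷ code (vecTree xs) ∷ y ∷ proj₁ (p y ≤-refl) ∷ 0 ∷ 0 ∷ [])
    (positive-derivable f xs y (λ z z<y → p z (m≤n⇒m≤1+n z<y)) ∷ eval-derivable f (y ∷ xs) (proj₂ (p y ≤-refl)) ∷ [])

  thm-derivable : ∀ {φ} → T ⊢ φ → ⊢ᵈ THM (formTree φ)
  thm-derivable {φ} (ax Tφ) = let v , e = proj₁ (proj₂ re ⌜ φ ⌝) (φ , Tφ , refl)
                                  ρ = code (formTree φ) ∷ ⌜ φ ⌝ ∷ v ∷ 0 ∷ 0 ∷ 0 ∷ [] in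
    by-rule thm-ax ρ (code-derivable φ ∷
      -- This is the code of an `EVAL` judgement, whose tag is 8, abstracted over the code of the
      -- program: the program enters the rule through `embed`, whose code is the right one only up
      -- to a proof.
      ≡.subst (λ p → Derivable (J (2 + J 0 8) (J (2 + p) (J (2 + code (vecTree (⌜ φ ⌝ ∷ []))) (J 1 v)))))
        (sym (codeAt-embed ρ (progTree (proj₁ re)))) (eval-derivable (proj₁ re) (⌜ φ ⌝ ∷ []) e) ∷ [])
  thm-derivable (ax-K {φ} {ψ}) = by-rule thm-K (code (formTree φ) ∷ code (formTree ψ) ∷ 0 ∷ 0 ∷ 0 ∷ 0 ∷ []) []
  thm-derivable (ax-S {φ} {ψ} {χ}) = by-rule thm-S (code (formTree φ) ∷ code (formTree ψ) ∷ code (formTree χ) ∷ 0 ∷ 0 ∷ 0 ∷ []) []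
  thm-derivable (ax-DN {φ}) = by-rule thm-DN (code (formTree φ) ∷ 0 ∷ 0 ∷ 0 ∷ 0 ∷ 0 ∷ []) []
  thm-derivable (ax-∀E {φ} t) = by-rule thm-∀E
    (code (formTree φ) ∷ code (termTree t) ∷ code (formTree (φ [ t ])) ∷ 0 ∷ 0 ∷ 0 ∷ []) (subst-derivable 0 t φ ∷ [])
  thm-derivable (ax-∀⇒ {φ} {ψ}) = by-rule thm-∀⇒ (code (formTree φ) ∷ code (formTree ψ) ∷ 0 ∷ 0 ∷ 0 ∷ 0 ∷ []) []
  thm-derivable (ax-∀V {φ}) = by-rule thm-∀V
    (code (formTree φ) ∷ code (formTree (shift 0 φ)) ∷ 0 ∷ 0 ∷ 0 ∷ 0 ∷ []) (shift-derivable 0 φ ∷ [])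
  thm-derivable (ax-refl t) = by-rule thm-refl (code (termTree t) ∷ 0 ∷ 0 ∷ 0 ∷ 0 ∷ 0 ∷ []) []
  thm-derivable (ax-leib {φ} t u) = by-rule thm-leib
    (code (termTree t) ∷ code (termTree u) ∷ code (formTree φ) ∷ code (formTree (φ [ t ])) ∷ code (formTree (φ [ u ])) ∷ 0 ∷ [])
    (subst-derivable 0 t φ ∷ subst-derivable 0 u φ ∷ [])
  thm-derivable (mp {φ} {ψ} p q) = by-rule thm-mp (code (formTree φ) ∷ code (formTree ψ) ∷ 0 ∷ 0 ∷ 0 ∷ 0 ∷ [])
    (thm-derivable p ∷ thm-derivable q ∷ [])
  thm-derivable (gen {φ} p) = by-rule thm-gen (code (formTree φ) ∷ 0 ∷ 0 ∷ 0 ∷ 0 ∷ 0 ∷ []) (thm-derivable p ∷ [])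

  provable-derivable : ∀ {φ} → T ⊢ φ → ⊢ᵈ PROVABLE ⌜ φ ⌝
  provable-derivable {φ} p = by-rule provable (⌜ φ ⌝ ∷ code (formTree φ) ∷ 0 ∷ 0 ∷ 0 ∷ 0 ∷ [])
    (code-derivable φ ∷ thm-derivable p ∷ [])

  refutable-derivable : ∀ {φ} → T ⊢ ¬' φ → ⊢ᵈ REFUTABLE ⌜ φ ⌝
  refutable-derivable {φ} p = by-rule refutable (⌜ φ ⌝ ∷ code (formTree φ) ∷ 0 ∷ 0 ∷ 0 ∷ 0 ∷ [])
    (code-derivable φ ∷ thm-derivable p ∷ [])

-- Rosser's formula

weaken : ∀ {T α φ} → T ⊢ φ → T +ax α ⊢ φ
weaken (ax p)        = ax (inj₁ p)
weaken ax-K          = ax-K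
weaken ax-S          = ax-S
weaken ax-DN         = ax-DN
weaken (ax-∀E t)     = ax-∀E t
weaken ax-∀⇒         = ax-∀⇒
weaken ax-∀V         = ax-∀V
weaken (ax-refl t)   = ax-refl t
weaken (ax-leib {φ} t u) = ax-leib {φ = φ} t u
weaken (mp p q)      = mp (weaken p) (weaken q)
weaken (gen p)       = gen (weaken p)

-- Rosser's trick, for stages p and numbers x: "x enters A at a stage by which it has not entered B".
module Separation (T : Theory) (Q : ExtendsQ T) (A B : Bounded 2) where

  open Entailment T
  open Arithmetic T Q
  open Decision T Q

  at-stage : Term → Term → Formula
  at-stage x p = inst A (p ∷ x ∷ []) ∧' ∀' (leq (var 0) (shiftT 0 p) ⇒ inst (B `⇒ `⊥) (var 0 ∷ shiftT 0 x ∷ []))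

  -- The second conjunct only makes the variable occur.
  separator : Formula
  separator = ∃' (at-stage (var 1) (var 0)) ∧' (var 0 ≐ var 0)

  oneFreeVar : OneFreeVar separator
  oneFreeVar = ⇒ˡ (⇒ʳ (⇒ˡ (≐ˡ here))) , only-0
    where
    only-0 : ∀ k → Free k separator → k ≡ 0
    only-0 k (⇒ˡ (⇒ʳ (⇒ˡ (≐ˡ here)))) = refl
    only-0 k (⇒ˡ (⇒ʳ (⇒ˡ (≐ʳ here)))) = refl
    only-0 k (⇒ˡ (⇒ˡ (⇒ˡ (∀- (⇒ˡ (⇒ˡ (⇒ˡ p))))))) with Free-inst A (var 0 ∷ var 1 ∷ []) p
    ... | suc zero , here = refl
    only-0 k (⇒ˡ (⇒ˡ (⇒ˡ (∀- (⇒ˡ (⇒ˡ (⇒ʳ (⇒ˡ (∀- (⇒ʳ p)))))))))) with Free-inst (B `⇒ `⊥) (var 0 ∷ var 2 ∷ []) p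
    ... | suc zero , here = refl
    only-0 k (⇒ˡ (⇒ˡ (⇒ˡ (∀- (⇒ˡ (⇒ˡ (⇒ʳ (⇒ˡ (∀- (⇒ˡ (⇒ˡ (∀- (⇒ˡ (≐ˡ (⊕ˡ ())))))))))))))))
    only-0 k (⇒ˡ (⇒ˡ (⇒ˡ (∀- (⇒ˡ (⇒ˡ (⇒ʳ (⇒ˡ (∀- (⇒ˡ (⇒ˡ (∀- (⇒ˡ (≐ˡ (⊕ʳ ())))))))))))))))
    only-0 k (⇒ˡ (⇒ˡ (⇒ˡ (∀- (⇒ˡ (⇒ˡ (⇒ʳ (⇒ˡ (∀- (⇒ˡ (⇒ˡ (∀- (⇒ˡ (≐ʳ ()))))))))))))))

  module _ (n : ℕ) where

    ¬B : Formula
    ¬B = inst (B `⇒ `⊥) (var 0 ∷ num n ∷ [])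

    at-stage-num : ∀ p → at-stage (num n) p ≡ inst A (p ∷ num n ∷ []) ∧' ∀' (leq (var 0) (shiftT 0 p) ⇒ ¬B)
    at-stage-num p = cong (λ x → inst A (p ∷ num n ∷ []) ∧' ∀' (leq (var 0) (shiftT 0 p) ⇒ inst (B `⇒ `⊥) (var 0 ∷ x ∷ [])))
      (shiftT-num 0 n)

    at-stage-[] : ∀ p → at-stage (num n) (var 0) [ p ] ≡ at-stage (num n) p
    at-stage-[] p = cong₂ (λ α β → α ∧' ∀' (leq (var 0) (shiftT 0 p) ⇒ β))
      (inst-[] A (n ∷ []) p)
      (trans (subst-inst 1 (shiftT 0 p) (B `⇒ `⊥) (var 0 ∷ shiftT 0 (num n) ∷ []))
        (cong (λ x → inst (B `⇒ `⊥) (var 0 ∷ x ∷ []))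
          (trans (substT-suc-shiftT 0 p (num n)) (cong (shiftT 0) (substT-num 0 p n)))))

    separator-num : separator [ num n ] ≡ ∃' (at-stage (num n) (var 0)) ∧' (num n ≐ num n)
    separator-num = cong (λ α → ∃' α ∧' (num n ≐ num n)) (cong₂ (λ α β → α ∧' ∀' (leq (var 0) (var 1) ⇒ β))
      (trans (subst-inst 1 (shiftT 0 (num n)) A (var 0 ∷ var 1 ∷ []))
        (cong (λ x → inst A (var 0 ∷ x ∷ [])) (shiftT-num 0 n)))
      (trans (subst-inst 2 (shiftT 0 (shiftT 0 (num n))) (B `⇒ `⊥) (var 0 ∷ var 2 ∷ []))
        (cong (λ x → inst (B `⇒ `⊥) (var 0 ∷ shiftT 0 x ∷ [])) (shiftT-num 0 n))))

    separator-holds : ∀ p → T ⊢ inst A (num p ∷ num n ∷ []) → (∀ q → T ⊢ inst (B `⇒ `⊥) (num q ∷ num n ∷ [])) →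
      T ⊢ separator [ num n ]
    separator-holds p a ¬b = ≡.subst (T ⊢_) (sym separator-num) (∧-intro []
      (mp (∃-intro (num p)) (≡.subst (T ⊢_) (sym (trans (at-stage-[] (num p)) (at-stage-num (num p)))) (∧-intro [] a
        (≡.subst (λ u → T ⊢ ∀' (leq (var 0) u ⇒ ¬B)) (sym (shiftT-num 0 p))
          (gen (upTo-num p (B `⇒ `⊥) (n ∷ []) (λ q _ → ¬b q) (var 0)))))))
      (ax-refl (num n)))

    -- `A` is refuted only at numerals, so an arbitrary stage y is compared with `p`. If y ≤ p, then
    -- y is a numeral and `A` fails there; otherwise p ≤ y, and `B` at `p` contradicts the second
    -- conjunct.
    separator-fails : ∀ p → T ⊢ inst B (num p ∷ num n ∷ []) → (∀ q → T ⊢ inst (A `⇒ `⊥) (num q ∷ num n ∷ [])) →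
      T ⊢ ¬' (separator [ num n ])
    separator-fails p b ¬a = ≡.subst (λ α → T ⊢ ¬' α) (sym separator-num)
      (∧-elim₁ Δ (hyp₀ []) ⨾ ∃-elim (≡.subst (λ α → T ⊢ ¬' α) (sym (at-stage-num (var 0)))
        (by-cases Γ (leq (var 0) (num p))
          (app Γ₁ (app Γ₁ (lift Γ₁ (upTo-num p (A `⇒ `⊥) (n ∷ []) (λ q _ → ¬a q) (var 0))) (hyp₀ Γ))
                  (∧-elim₁ Γ₁ (hyp₁ [])))
          (app Γ₂ (app Γ₂ (app Γ₂ (lift Γ₂ at-p) (∧-elim₂ Γ₂ (hyp₁ []))) (app Γ₂ (lift Γ₂ (leq-connex p (var 0))) (hyp₀ Γ)))
                  (lift Γ₂ b)))))
      where
      Δ  = ∃' (at-stage (num n) (var 0)) ∧' (num n ≐ num n) ∷ []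
      Γ  = inst A (var 0 ∷ num n ∷ []) ∧' ∀' (leq (var 0) (var 1) ⇒ ¬B) ∷ []
      Γ₁ = leq (var 0) (num p) ∷ Γ
      Γ₂ = ¬' (leq (var 0) (num p)) ∷ Γ
      at-p : T ⊢ ∀' (leq (var 0) (var 1) ⇒ ¬B) ⇒ leq (num p) (var 0) ⇒ inst (B `⇒ `⊥) (num p ∷ num n ∷ [])
      at-p = ≡.subst (λ α → T ⊢ ∀' (leq (var 0) (var 1) ⇒ ¬B) ⇒ leq (num p) (var 0) ⇒ α) (inst-[] (B `⇒ `⊥) (n ∷ []) (num p))
        (ax-∀E (num p))

module Rosser (T : Theory) (consistent : Consistent T) (re : RETheory T) (Q : ExtendsQ T) where

  open Entailment T
  open Decision T Q
  open Rules (proj₁ re)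
  open Soundness T re
  open Completeness T re

  proof refutation : Bounded 2
  proof      = derivable (codeTm (PROVABLE (` zero)))
  refutation = derivable (codeTm (REFUTABLE (` zero)))

  derivable-true : ∀ (P : Pattern 1) x → Derivable (codeAt (x ∷ []) P) → ∃ λ p → T ⊢ inst (derivable (codeTm P)) (nums (p ∷ x ∷ []))
  derivable-true P x d =
    let p , q = derivable-intro (codeTm P) x (≡.subst Derivable (sym (⟦codeTm⟧ P (x ∷ []))) d) in p , true⇒⊢ (derivable (codeTm P)) _ q

  -- For each `p` this is a true bounded sentence, since a coded derivation would make the judgement
  -- true by soundness; hence `T` proves it.
  derivable-false : ∀ (P : Pattern 1) x → ¬ Meaning (treeAt (x ∷ []) P) →
    ∀ p → T ⊢ inst (derivable (codeTm P) `⇒ `⊥) (nums (p ∷ x ∷ []))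
  derivable-false P x ¬m p = true⇒⊢ (derivable (codeTm P) `⇒ `⊥) _ λ q →
    ¬m (≡.subst Meaning (decode-codeAt (x ∷ []) P)
      (sound Meaning Meaning-closed (≡.subst Derivable (⟦codeTm⟧ P (x ∷ [])) (derivable-elim (codeTm P) p x q))))

  -- Injectivity of the coding makes θ the only formula with its code; then consistency of `T`
  -- applies.
  ¬proof : ∀ {θ} → T ⊢ ¬' θ → ¬ Meaning (PROVABLE ⌜ θ ⌝)
  ¬proof {θ} d (φ , eq , d′) with refl ← ⌜⌝-injective θ φ eq = consistent (mp d d′)

  ¬refutation : ∀ {θ} → T ⊢ θ → ¬ Meaning (REFUTABLE ⌜ θ ⌝)
  ¬refutation {θ} d (φ , eq , d′) with refl ← ⌜⌝-injective θ φ eq = consistent (mp d′ d)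

  open Separation T Q refutation proof public

  separator-refutable : ∀ θ → T ⊢ θ → T ⊢ ¬' (separator [ ⌜ θ ⌝̇ ])
  separator-refutable θ d = let p , q = derivable-true (PROVABLE (` zero)) ⌜ θ ⌝ (provable-derivable d) in
    separator-fails ⌜ θ ⌝ p q (derivable-false (REFUTABLE (` zero)) ⌜ θ ⌝ (¬refutation d))

  separator-provable : ∀ θ → T ⊢ ¬' θ → T ⊢ separator [ ⌜ θ ⌝̇ ]
  separator-provable θ d = let p , q = derivable-true (REFUTABLE (` zero)) ⌜ θ ⌝ (refutable-derivable d) in
    separator-holds ⌜ θ ⌝ p q (derivable-false (PROVABLE (` zero)) ⌜ θ ⌝ (¬proof d))

-- If `T` decided θ, it would decide Ψ at ⌜θ⌝ the opposite way, and adding the equivalence would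
-- then produce ⊥'.
fixed-point-independent : ∀ {T} Ψ →
  (∀ θ → T ⊢ θ → T ⊢ ¬' (Ψ [ ⌜ θ ⌝̇ ])) → (∀ θ → T ⊢ ¬' θ → T ⊢ Ψ [ ⌜ θ ⌝̇ ]) →
  (Σ Formula λ θ → Sentence θ × Consistent (T +ax ((Ψ [ ⌜ θ ⌝̇ ]) ⇔ θ))) →
  Σ Formula λ ρ → Sentence ρ × ¬ (T ⊢ ρ) × ¬ (T ⊢ ¬' ρ)
fixed-point-independent {T} Ψ refutes proves (θ , sentence , consistent) = θ , sentence ,
  (λ d → consistent (mp (weaken (refutes θ d)) (mp (∧-elim₂ [] equivalence) (weaken d)))) ,
  (λ d → consistent (mp (weaken d) (mp (∧-elim₁ [] equivalence) (weaken (proves θ d)))))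
  where
  open Entailment (T +ax ((Ψ [ ⌜ θ ⌝̇ ]) ⇔ θ)) using (∧-elim₁; ∧-elim₂)
  equivalence : T +ax ((Ψ [ ⌜ θ ⌝̇ ]) ⇔ θ) ⊢ (Ψ [ ⌜ θ ⌝̇ ]) ⇔ θ
  equivalence = ax (inj₂ refl)

theorem3p5 : (T : Theory) → SentenceTheory T → Consistent T → RETheory T → ExtendsQ T →
    WeakDiagonal T →
    Σ Formula λ ρ → Sentence ρ × ¬ (T ⊢ ρ) × ¬ (T ⊢ ¬' ρ)
theorem3p5 T _ consistent re Q diagonal =
  fixed-point-independent separator separator-refutable separator-provable (diagonal separator oneFreeVar)
  where open Rosser T consistent re Q
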